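{- Let $n \geq 2$ and $m \geq 3$ be integers, let $\mathcal{V}=\mathcal{V}_1\otimes \dots \otimes \mathcal{V}_m$ be a tensor product of vector spaces over a field $\mathbb{F}$, and let $\{x_a: a \in [n]\}$ be a multiset of product tensors in $\mathcal{V}$ with $x_a=x_{a,1}\otimes\dots\otimes x_{a,m}$. For each $S \subseteq [n]$ and $J \subseteq [m]$, let $d_J^S=\dim\operatorname{span}\{\bigotimes_{j \in J} x_{a,j} : a \in S\}$. If for every subset $S \subseteq [n]$ with $2 \leq |S| \leq n$ there exists a partition $J_1 \sqcup \dots \sqcup J_t =[m]$ (which may depend on $S$) such that $2 |S| \leq \sum_{i \in [t]} (d_{J_i}^S-1)+1$, then $\sum_{a \in [n]} x_a$ constitutes a unique tensor rank decomposition.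
   Context: $[n]=\{1,\dots,n\}$. A product tensor is a non-zero tensor $z_1\otimes\dots\otimes z_m$, $z_j\in\mathcal{V}_j$. A decomposition $v=\sum_{a\in[n]}x_a$ into product tensors constitutes a unique tensor rank decomposition if for every non-negative integer $r\le n$ and every multiset of product tensors $\{y_a:a\in[r]\}$ with $v=\sum_{a\in[r]}y_a$, it holds that $r=n$ and $\{x_a\}=\{y_a\}$ as multisets. -}

module Defs where

open import Level using (Level; _⊔_; suc)
open import Algebra.Bundles using (CommutativeRing)
open import Algebra.Definitions using (Invertible)
open import Algebra.Module.Bundles using (Module)
open import Algebra.Module.Structures using (IsModule)
open import Algebra.Module.Structures.Biased using (IsModuleFromLeft)
import Algebra.Properties.Monoid.Sum as MonoidSum
open import Data.Fin.Base using (Fin)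
open import Data.Fin.Permutation using (Permutation; _⟨$⟩ʳ_)
open import Data.Fin.Subset using (Subset; Nonempty; _∈_)
open import Data.Nat.Base using (ℕ; _≤_)
open import Data.Nat.Properties using (+-0-monoid)
open import Data.Product.Base using (Σ; ∃; _×_; _,_)
open import Relation.Binary.PropositionalEquality.Core using (_≡_; _≢_)
open import Relation.Unary using (Pred)

open MonoidSum +-0-monoid public using () renaming (sum to sumℕ)

-- The standard library only has fields with an apartness relation; this is the
-- usual notion, where every element different from zero is invertible.
record Field (c ℓ : Level) : Set (suc (c ⊔ ℓ)) where
  field
    commutativeRing : CommutativeRing c ℓ

  open CommutativeRing commutativeRing public

  field
    1≉0        : 1# ≉ 0#
    invertible : ∀ x → x ≉ 0# → Invertible _≈_ 1# _*_ x

VectorSpace : ∀ {c ℓ} → Field c ℓ → (v ℓv : Level) → Set (c ⊔ ℓ ⊔ suc (v ⊔ ℓv))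
VectorSpace F v ℓv = Module (Field.commutativeRing F) v ℓv

module _ {c ℓ v ℓv : Level} (F : Field c ℓ) (W : VectorSpace F v ℓv) where
  open Field F using (Carrier; _≈_; 0#)
  open Module W

  sumᴹ : ∀ {k} → (Fin k → Carrierᴹ) → Carrierᴹ
  sumᴹ = MonoidSum.sum +ᴹ-monoid

  data Span {k} {K : Set k} (f : K → Carrierᴹ) : Pred Carrierᴹ (c ⊔ v ⊔ ℓv ⊔ k) where
    gen   : ∀ a → Span f (f a)
    zero  : Span f 0ᴹ
    add   : ∀ {u w} → Span f u → Span f w → Span f (u +ᴹ w)
    scale : ∀ r {u} → Span f u → Span f (r *ₗ u)
    resp  : ∀ {u w} → u ≈ᴹ w → Span f u → Span f w

  LinearlyIndependent : ∀ {k} → (Fin k → Carrierᴹ) → Set (c ⊔ ℓ ⊔ ℓv)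
  LinearlyIndependent {k} b =
    ∀ (r : Fin k → Carrier) → sumᴹ (λ i → r i *ₗ b i) ≈ᴹ 0ᴹ → ∀ i → r i ≈ 0#

  -- HasDim P d : the subspace P has a basis with d elements.
  HasDim : ∀ {p} → Pred Carrierᴹ p → ℕ → Set (c ⊔ ℓ ⊔ v ⊔ ℓv ⊔ p)
  HasDim P d = Σ (Fin d → Carrierᴹ) λ b →
    (∀ i → P (b i)) × LinearlyIndependent b × (∀ w → P w → Span b w)

-- The tensor product of a finite family of vector spaces, by generators and
-- relations: terms in the generators ⊗ z, modulo the least vector space
-- congruence making ⊗ multilinear.
module _ {c ℓ v ℓv : Level} (F : Field c ℓ) {I : Set} (V : I → VectorSpace F v ℓv) where
  open Field F using (Carrier; _≈_; _+_; _*_; -_; 0#; 1#; commutativeRing)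
  private
    module K = Field F
    module V i = Module (V i)

  infixl 6 _⊕_
  infixr 7 _⊙_
  infix  4 _≈⊗_

  data Tensor : Set (c ⊔ v) where
    ⊗_  : (∀ i → V.Carrierᴹ i) → Tensor
    𝟎   : Tensor
    _⊕_ : Tensor → Tensor → Tensor
    _⊙_ : Carrier → Tensor → Tensor

  data _≈⊗_ : Tensor → Tensor → Set (c ⊔ ℓ ⊔ v ⊔ ℓv) where
    ≈refl       : ∀ {s} → s ≈⊗ s
    ≈sym        : ∀ {s t} → s ≈⊗ t → t ≈⊗ s
    ≈trans      : ∀ {s t u} → s ≈⊗ t → t ≈⊗ u → s ≈⊗ u
    ⊕-cong      : ∀ {s s′ t t′} → s ≈⊗ s′ → t ≈⊗ t′ → s ⊕ t ≈⊗ s′ ⊕ t′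
    ⊙-cong      : ∀ {r r′ s s′} → r ≈ r′ → s ≈⊗ s′ → r ⊙ s ≈⊗ r′ ⊙ s′
    ⊕-assoc     : ∀ s t u → (s ⊕ t) ⊕ u ≈⊗ s ⊕ (t ⊕ u)
    ⊕-comm      : ∀ s t → s ⊕ t ≈⊗ t ⊕ s
    ⊕-identityˡ : ∀ s → 𝟎 ⊕ s ≈⊗ s
    ⊙-zeroˡ     : ∀ s → 0# ⊙ s ≈⊗ 𝟎
    ⊙-identityˡ : ∀ s → 1# ⊙ s ≈⊗ s
    ⊙-assoc     : ∀ r r′ s → (r * r′) ⊙ s ≈⊗ r ⊙ (r′ ⊙ s)
    ⊙-distribˡ  : ∀ r s t → r ⊙ (s ⊕ t) ≈⊗ r ⊙ s ⊕ r ⊙ t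
    ⊙-distribʳ  : ∀ s r r′ → (r + r′) ⊙ s ≈⊗ r ⊙ s ⊕ r′ ⊙ s
    ⊗-cong      : ∀ {z z′} → (∀ i → V._≈ᴹ_ i (z i) (z′ i)) → ⊗ z ≈⊗ ⊗ z′
    -- Additivity and homogeneity in the i-th slot; the tuples agree elsewhere.
    ⊗-add       : ∀ i {z z₁ z₂} → V._≈ᴹ_ i (z i) (V._+ᴹ_ i (z₁ i) (z₂ i)) →
                  (∀ j → j ≢ i → V._≈ᴹ_ j (z j) (z₁ j) × V._≈ᴹ_ j (z j) (z₂ j)) →
                  ⊗ z ≈⊗ ⊗ z₁ ⊕ ⊗ z₂
    ⊗-scale     : ∀ i r {z z₁} → V._≈ᴹ_ i (z i) (V._*ₗ_ i r (z₁ i)) →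
                  (∀ j → j ≢ i → V._≈ᴹ_ j (z j) (z₁ j)) →
                  ⊗ z ≈⊗ r ⊙ ⊗ z₁

  private
    ⊖_ : Tensor → Tensor
    ⊖ s = (- 1#) ⊙ s

    ⊕-identityʳ : ∀ s → s ⊕ 𝟎 ≈⊗ s
    ⊕-identityʳ s = ≈trans (⊕-comm s 𝟎) (⊕-identityˡ s)

    ⊙-zeroʳ : ∀ r → r ⊙ 𝟎 ≈⊗ 𝟎
    ⊙-zeroʳ r =
      ≈trans (⊙-cong K.refl (≈sym (⊙-zeroˡ 𝟎)))
      (≈trans (≈sym (⊙-assoc r 0# 𝟎))
      (≈trans (⊙-cong (K.zeroʳ r) ≈refl) (⊙-zeroˡ 𝟎)))

    ⊖-inverseˡ : ∀ s → ⊖ s ⊕ s ≈⊗ 𝟎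
    ⊖-inverseˡ s =
      ≈trans (⊕-cong ≈refl (≈sym (⊙-identityˡ s)))
      (≈trans (≈sym (⊙-distribʳ s (- 1#) 1#))
      (≈trans (⊙-cong (K.-‿inverseˡ 1#) ≈refl) (⊙-zeroˡ s)))

    ⨂-isModule : IsModule commutativeRing _≈⊗_ _⊕_ 𝟎 ⊖_ _⊙_ (λ s r → r ⊙ s)
    ⨂-isModule = IsModuleFromLeft.isModule record
      { isLeftModule = record
        { isLeftSemimodule = record
          { +ᴹ-isCommutativeMonoid = record
            { isMonoid = record
              { isSemigroup = record
                { isMagma = record
                  { isEquivalence = record { refl = ≈refl ; sym = ≈sym ; trans = ≈trans }
                  ; ∙-cong        = ⊕-cong
                  }
                ; assoc = ⊕-assoc
                }
              ; identity = ⊕-identityˡ , ⊕-identityʳ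
              }
            ; comm = ⊕-comm
            }
          ; isPreleftSemimodule = record
            { *ₗ-cong      = ⊙-cong
            ; *ₗ-zeroˡ     = ⊙-zeroˡ
            ; *ₗ-distribʳ  = ⊙-distribʳ
            ; *ₗ-identityˡ = ⊙-identityˡ
            ; *ₗ-assoc     = ⊙-assoc
            ; *ₗ-zeroʳ     = ⊙-zeroʳ
            ; *ₗ-distribˡ  = ⊙-distribˡ
            }
          }
        ; -ᴹ‿cong    = ⊙-cong K.refl
        ; -ᴹ‿inverse = ⊖-inverseˡ , λ s → ≈trans (⊕-comm s (⊖ s)) (⊖-inverseˡ s)
        }
      }

  ⨂ : VectorSpace F (c ⊔ v) (c ⊔ ℓ ⊔ v ⊔ ℓv)
  ⨂ = record { isModule = ⨂-isModule }

  open Module ⨂ using () renaming (_≉ᴹ_ to _≉⊗_)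

  IsProductTensor : Tensor → Set (c ⊔ ℓ ⊔ v ⊔ ℓv)
  IsProductTensor s = s ≉⊗ 𝟎 × ∃ λ z → s ≈⊗ ⊗ z

  -- Multisets of size k are families indexed by Fin k, compared up to a bijection
  -- of the index sets.
  IsUniqueTensorRankDecomposition :
    (s : Tensor) {n : ℕ} → (Fin n → Tensor) → Set (c ⊔ ℓ ⊔ v ⊔ ℓv)
  IsUniqueTensorRankDecomposition s {n} x =
    (∀ a → IsProductTensor (x a)) ×
    s ≈⊗ sumᴹ F ⨂ x ×
    (∀ r → r ≤ n → (y : Fin r → Tensor) → (∀ a → IsProductTensor (y a)) →
       s ≈⊗ sumᴹ F ⨂ y →
       r ≡ n × Σ (Permutation n r) λ σ → ∀ a → x a ≈⊗ y (σ ⟨$⟩ʳ a))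

module _ {c ℓ v ℓv : Level} (F : Field c ℓ) {m : ℕ} (V : Fin m → VectorSpace F v ℓv) where

  ⨂[_] : Subset m → VectorSpace F (c ⊔ v) (c ⊔ ℓ ⊔ v ⊔ ℓv)
  ⨂[ J ] = ⨂ F {I = ∃ (_∈ J)} (λ (j , _) → V j)

  -- IsDim x S J d : d = dim span { ⨂_{j ∈ J} x_{a,j} : a ∈ S }
  IsDim : ∀ {n} → (Fin n → ∀ j → Module.Carrierᴹ (V j)) →
          Subset n → Subset m → ℕ → Set (c ⊔ ℓ ⊔ v ⊔ ℓv)
  IsDim x S J = HasDim F ⨂[ J ] (Span F ⨂[ J ] {K = ∃ (_∈ S)} λ (a , _) → ⊗ λ (j , _) → x a j)

record IsPartition {t m : ℕ} (J : Fin t → Subset m) : Set where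
  field
    nonempty : ∀ i → Nonempty (J i)
    disjoint : ∀ {i k j} → j ∈ J i → j ∈ J k → i ≡ k
    covers   : ∀ j → ∃ λ i → j ∈ J i

{-# OPTIONS --safe #-}

-- Let x₁ + … + xₙ = y₁ + … + y_r with r ≤ n.  The family of all xₐ and −y_b sums to zero, so it
-- is a disjoint union of zero-sum subfamilies none of which has a proper non-empty zero-sum
-- subfamily.  Let such a minimal subfamily G contain the xₐ with a ∈ S and q of the y_b.  If
-- |S| ≥ 2, minimality makes G connected (no proper subset of it carries a direct summand of its
-- span), and a connected family of product tensors satisfies
--     Σᵢ (dim span of the J_i-parts − 1) + 1 ≤ dim span G < |G| = |S| + q,
-- so the hypothesis gives |S| < q.  As also 1 ≤ q when |S| = 1 (the xₐ are non-zero), r ≤ n forces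
-- every G to be a pair {xₐ, −y_b}, that is xₐ = y_b.
--
-- Connected families only become more connected when a tensor factor is dropped, so the dimension
-- bound reduces to two factors, dim Z ≥ dim X + dim Y − 1 for Z = X ⊗ Y.  There it is proved by
-- adding one ear after another to a subset S on which it holds: an ear is a minimal set D outside
-- S such that some relation of Z supported on S ∪ D does not restrict to a relation on S.  Adding D
-- raises dim Z by |D| − 1, and dim X + dim Y by at most |D| − 1.
module Submission where

open import Defs
open import Level using (Level; _⊔_; Lift; lift; lower)
open import Algebra.Bundles using (CommutativeMonoid)
open import Algebra.Module.Bundles using (Module)
import Algebra.Properties.CommutativeMonoid.Sum as CMSum
open import Axiom.ExcludedMiddle using (ExcludedMiddle)
open import Data.Bool.Base using (if_then_else_)
open import Data.Empty using (⊥-elim)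
open import Data.Fin.Base using (Fin; zero; suc; _↑ˡ_; _↑ʳ_; splitAt; inject≤)
open import Data.Fin.Permutation using (permutation)
open import Data.Fin.Properties using (_≟_; any?; splitAt-↑ˡ; splitAt-↑ʳ)
open import Data.Fin.Subset using (Subset; ∣_∣; _∈_; _∉_; _⊆_; _∪_; _─_; ⁅_⁆; ⊥; ⊤; Nonempty; inside; outside) renaming (_-_ to _∖_)
open import Data.Fin.Subset.Properties
open import Data.List.Base as List using (List; []; _∷_)
open import Data.List.Relation.Unary.All as All using (All; []; _∷_)
open import Data.List.Relation.Unary.All.Properties using (++⁻ˡ; ++⁻ʳ; map⁻)
open import Data.Nat.Base as ℕ using (ℕ; z≤n; s≤s; _≤_; _<_; _∸_)
import Data.Nat.Properties as ℕ
open import Algebra.Properties.CommutativeSemigroup ℕ.+-commutativeSemigroup using () renaming (interchange to +-interchange)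
open import Data.Product.Base using (Σ; ∃; _×_; _,_; proj₁; proj₂)
open import Data.Sum.Base using (inj₁; inj₂; [_,_]′)
open import Data.Vec.Base as Vec using (Vec; []; _∷_; here; there; _++_; lookup; _[_]≔_; replicate)
open import Data.Vec.Properties using (lookup∘update; lookup∘update′; lookup-replicate; lookup-++ˡ; lookup-++ʳ; take++drop≡id; []=⇒lookup; lookup⇒[]=)
open import Data.Vec.Properties.WithK using ([]=-irrelevant)
open import Function.Base using (_∘_; id)
open import Relation.Binary.PropositionalEquality.Core as ≡ using (_≡_; _≢_)
open import Relation.Nullary using (Dec; yes; no; does; ¬_; contradiction)
open import Relation.Nullary.Decidable using (¬?; _×-dec_; decidable-stable; map′; toSum)
open import Relation.Unary using (Pred)

-- Preliminaries: excluded middle at lower levels, cardinalities of finite subsets.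

lower-em : ∀ {a} b → ExcludedMiddle (a ⊔ b) → ExcludedMiddle a
lower-em b em {P} = map′ lower lift (em {Lift b P})

∣p∪q∣≤∣p∣+∣q∣ : ∀ {n} (p q : Subset n) → ∣ p ∪ q ∣ ≤ ∣ p ∣ ℕ.+ ∣ q ∣
∣p∪q∣≤∣p∣+∣q∣ []            []            = z≤n
∣p∪q∣≤∣p∣+∣q∣ (outside ∷ p) (outside ∷ q) = ∣p∪q∣≤∣p∣+∣q∣ p q
∣p∪q∣≤∣p∣+∣q∣ (outside ∷ p) (inside ∷ q)  =
  ≡.subst (ℕ.suc ∣ p ∪ q ∣ ≤_) (≡.sym (ℕ.+-suc ∣ p ∣ ∣ q ∣)) (s≤s (∣p∪q∣≤∣p∣+∣q∣ p q))
∣p∪q∣≤∣p∣+∣q∣ (inside ∷ p)  (outside ∷ q) = s≤s (∣p∪q∣≤∣p∣+∣q∣ p q)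
∣p∪q∣≤∣p∣+∣q∣ (inside ∷ p)  (inside ∷ q)  =
  s≤s (ℕ.≤-trans (∣p∪q∣≤∣p∣+∣q∣ p q) (ℕ.+-monoʳ-≤ ∣ p ∣ (ℕ.n≤1+n ∣ q ∣)))

disjoint⇒∣p∣+∣q∣≤∣p∪q∣ : ∀ {n} (p q : Subset n) → (∀ {x} → x ∈ p → x ∉ q) →
                         ∣ p ∣ ℕ.+ ∣ q ∣ ≤ ∣ p ∪ q ∣
disjoint⇒∣p∣+∣q∣≤∣p∪q∣ []            []            p∩q = z≤n
disjoint⇒∣p∣+∣q∣≤∣p∪q∣ (outside ∷ p) (outside ∷ q) p∩q =
  disjoint⇒∣p∣+∣q∣≤∣p∪q∣ p q λ x∈p x∈q → p∩q (there x∈p) (there x∈q)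
disjoint⇒∣p∣+∣q∣≤∣p∪q∣ (outside ∷ p) (inside ∷ q)  p∩q =
  ≡.subst (_≤ ℕ.suc ∣ p ∪ q ∣) (≡.sym (ℕ.+-suc ∣ p ∣ ∣ q ∣))
    (s≤s (disjoint⇒∣p∣+∣q∣≤∣p∪q∣ p q λ x∈p x∈q → p∩q (there x∈p) (there x∈q)))
disjoint⇒∣p∣+∣q∣≤∣p∪q∣ (inside ∷ p)  (outside ∷ q) p∩q =
  s≤s (disjoint⇒∣p∣+∣q∣≤∣p∪q∣ p q λ x∈p x∈q → p∩q (there x∈p) (there x∈q))
disjoint⇒∣p∣+∣q∣≤∣p∪q∣ (inside ∷ p)  (inside ∷ q)  p∩q = contradiction here (p∩q here)

x∈p─q⇒x∉q : ∀ {n} (p q : Subset n) {x} → x ∈ p ─ q → x ∉ q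
x∈p─q⇒x∉q (_ ∷ p)      (_ ∷ q)      (there x∈p─q) (there x∈q) = x∈p─q⇒x∉q p q x∈p─q x∈q
x∈p─q⇒x∉q (s ∷ p)      (inside ∷ q) ()            here

x∈p-y⇒x≢y : ∀ {n} (p : Subset n) {x y} → x ∈ p ∖ y → x ≢ y
x∈p-y⇒x≢y p {y = y} x∈p-y ≡.refl = x∈p─q⇒x∉q p ⁅ y ⁆ x∈p-y (x∈⁅x⁆ y)

∣p∣≤∣p─q∣+∣q∣ : ∀ {n} (p q : Subset n) → ∣ p ∣ ≤ ∣ p ─ q ∣ ℕ.+ ∣ q ∣
∣p∣≤∣p─q∣+∣q∣ p q = ℕ.≤-trans (p⊆q⇒∣p∣≤∣q∣ p⊆) (∣p∪q∣≤∣p∣+∣q∣ (p ─ q) q)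
  where
  p⊆ : p ⊆ (p ─ q) ∪ q
  p⊆ {x} x∈p with x ∈? q
  ... | yes x∈q = x∈p∪q⁺ (inj₂ x∈q)
  ... | no  x∉q = x∈p∪q⁺ (inj₁ (x∈p∧x∉q⇒x∈p─q x∈p x∉q))

∣p─q∣+∣q∣≤∣p∣ : ∀ {n} {p q : Subset n} → q ⊆ p → ∣ p ─ q ∣ ℕ.+ ∣ q ∣ ≤ ∣ p ∣
∣p─q∣+∣q∣≤∣p∣ {p = p} {q} q⊆p =
  ℕ.≤-trans (disjoint⇒∣p∣+∣q∣≤∣p∪q∣ (p ─ q) q (x∈p─q⇒x∉q p q))
    (p⊆q⇒∣p∣≤∣q∣ ([ p─q⊆p p q , q⊆p ]′ ∘ x∈p∪q⁻ (p ─ q) q))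

∣p∣≤1+∣p-x∣ : ∀ {n} (p : Subset n) x → ∣ p ∣ ≤ ℕ.suc ∣ p ∖ x ∣
∣p∣≤1+∣p-x∣ p x = ≡.subst (∣ p ∣ ≤_)
  (≡.trans (≡.cong (∣ p ∖ x ∣ ℕ.+_) (∣⁅x⁆∣≡1 x)) (ℕ.+-comm _ 1)) (∣p∣≤∣p─q∣+∣q∣ p ⁅ x ⁆)

p⊆q∧∣q∣≤∣p∣⇒q⊆p : ∀ {n} {p q : Subset n} → p ⊆ q → ∣ q ∣ ≤ ∣ p ∣ → q ⊆ p
p⊆q∧∣q∣≤∣p∣⇒q⊆p {p = p} p⊆q ∣q∣≤∣p∣ {x} x∈q with x ∈? p
... | yes x∈p = x∈p
... | no  x∉p = contradiction (p⊂q⇒∣p∣<∣q∣ (p⊆q , x , x∈q , x∉p)) (ℕ.≤⇒≯ ∣q∣≤∣p∣)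

0<∣p∣⇒nonempty : ∀ {n} (p : Subset n) → 0 < ∣ p ∣ → Nonempty p
0<∣p∣⇒nonempty {n} p 0<∣p∣ with nonempty? p
... | yes ne = ne
... | no  ¬ne = contradiction
  (≡.subst (0 <_) (≡.trans (≡.cong ∣_∣ (Empty-unique ¬ne)) (∣⊥∣≡0 n)) 0<∣p∣) λ ()

x∈p⇒0<∣p∣ : ∀ {n} {p : Subset n} {x} → x ∈ p → 0 < ∣ p ∣
x∈p⇒0<∣p∣ x∈p = ℕ.≤-trans (s≤s z≤n) (x∈p⇒∣p-x∣<∣p∣ x∈p)

∣p∣≤1⇒unique : ∀ {n} {p : Subset n} {x y} → ∣ p ∣ ≤ 1 → x ∈ p → y ∈ p → x ≡ y
∣p∣≤1⇒unique {p = p} {x} {y} ∣p∣≤1 x∈p y∈p with y ≟ x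
... | yes y≡x = ≡.sym y≡x
... | no  y≢x = contradiction (ℕ.≤-trans (x∈p⇒∣p-x∣<∣p∣ x∈p) ∣p∣≤1)
  (ℕ.≤⇒≯ (x∈p⇒0<∣p∣ (x∈p∧x≢y⇒x∈p-y y∈p y≢x)))

∣++∣ : ∀ {m n} (p : Subset m) (q : Subset n) → ∣ p ++ q ∣ ≡ ∣ p ∣ ℕ.+ ∣ q ∣
∣++∣ []            q = ≡.refl
∣++∣ (inside ∷ p)  q = ≡.cong ℕ.suc (∣++∣ p q)
∣++∣ (outside ∷ p) q = ∣++∣ p q

-- Finite sums and coefficient vectors.

module FiniteSum {a ℓ} (M : CommutativeMonoid a ℓ) where
  open CommutativeMonoid M
  open CMSum M public using (sum; sum-replicate-zero; ∑-distrib-+; ∑-comm)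

  sum-cong : ∀ {n} {f g : Fin n → Carrier} → (∀ i → f i ≈ g i) → sum f ≈ sum g
  sum-cong = CMSum.sum-cong-≋ M

  sum-zero : ∀ {n} {f : Fin n → Carrier} → (∀ i → f i ≈ ε) → sum f ≈ ε
  sum-zero {n} f≈0 = trans (sum-cong f≈0) (sum-replicate-zero n)

  sum-only : ∀ {n} (f : Fin n → Carrier) i → (∀ j → j ≢ i → f j ≈ ε) → sum f ≈ f i
  sum-only f zero    f≈0 =
    trans (∙-congˡ (sum-zero λ j → f≈0 (suc j) λ ())) (identityʳ _)
  sum-only f (suc i) f≈0 = trans (∙-cong (f≈0 zero λ ())
    (sum-only (f ∘ suc) i λ j j≢i → f≈0 (suc j) λ { ≡.refl → j≢i ≡.refl })) (identityˡ _)

  sum-↑ : ∀ m {n} (f : Fin (m ℕ.+ n) → Carrier) →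
          sum f ≈ sum (λ i → f (i ↑ˡ n)) ∙ sum (λ j → f (m ↑ʳ j))
  sum-↑ ℕ.zero    f = sym (identityˡ _)
  sum-↑ (ℕ.suc m) f = trans (∙-congˡ (sum-↑ m (f ∘ suc))) (sym (assoc _ _ _))

module Coefficients {c ℓ} (F : Field c ℓ) where
  open Field F public hiding (zero)
  open FiniteSum +-commutativeMonoid public
  open import Algebra.Properties.Semiring.Sum semiring public
    using (*-distribˡ-sum; *-distribʳ-sum)

  open import Algebra.Properties.Ring ring public
    using (-1*x≈-x; x[y-z]≈xy-xz; -‿+-comm; -‿involutive; -0#≈0#; -‿distribˡ-*)

  Coeffs : ℕ → Set c
  Coeffs N = Fin N → Carrier

  x*0 : ∀ x {y} → y ≈ 0# → x * y ≈ 0#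
  x*0 x y≈0 = trans (*-congˡ y≈0) (zeroʳ x)

  0*x : ∀ {x} y → x ≈ 0# → x * y ≈ 0#
  0*x y x≈0 = trans (*-congʳ x≈0) (zeroˡ y)

  x-x≈0 : ∀ {x y} → x ≈ y → x - y ≈ 0#
  x-x≈0 x≈y = trans (+-congʳ x≈y) (-‿inverseʳ _)

  [x-y]+[y-z]≈x-z : ∀ x y z → (x - y) + (y - z) ≈ x - z
  [x-y]+[y-z]≈x-z x y z = trans (+-assoc x (- y) (y - z))
    (+-congˡ (trans (sym (+-assoc (- y) y (- z)))
      (trans (+-congʳ (-‿inverseˡ y)) (+-identityˡ (- z)))))

  x-[x-y]≈y : ∀ x y → x - (x - y) ≈ y
  x-[x-y]≈y x y = trans (+-congˡ (sym (-‿+-comm x (- y))))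
    (trans (sym (+-assoc x (- x) (- - y)))
      (trans (+-cong (-‿inverseʳ x) (-‿involutive y)) (+-identityˡ y)))

  δ : ∀ {N} → Fin N → Coeffs N
  δ a b = if does (a ≟ b) then 1# else 0#

  δ-diag : ∀ {N} (a : Fin N) → δ a a ≈ 1#
  δ-diag a with a ≟ a
  ... | yes _   = refl
  ... | no  a≢a = contradiction ≡.refl a≢a

  δ-off : ∀ {N} {a b : Fin N} → a ≢ b → δ a b ≈ 0#
  δ-off {a = a} {b} a≢b with a ≟ b
  ... | yes a≡b = contradiction a≡b a≢b
  ... | no  _   = refl

  sum-*δ : ∀ {N} (f : Coeffs N) b → sum (λ a → f a * δ a b) ≈ f b
  sum-*δ f b = trans (sum-only _ b λ a a≢b → x*0 (f a) (δ-off a≢b))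
    (trans (*-congˡ (δ-diag b)) (*-identityʳ _))

  sum-δ* : ∀ {N} a (f : Coeffs N) → sum (λ b → δ a b * f b) ≈ f a
  sum-δ* a f = trans (sum-only _ a λ b b≢a → 0*x (f b) (δ-off (b≢a ∘ ≡.sym)))
    (trans (*-congʳ (δ-diag a)) (*-identityˡ _))

  sum-sub : ∀ {N} (f g : Coeffs N) → sum (λ a → f a - g a) ≈ sum f - sum g
  sum-sub f g = trans (∑-distrib-+ f (λ a → - g a)) (+-congˡ (neg g))
    where
    neg : ∀ {N} (g : Coeffs N) → sum (λ a → - g a) ≈ - sum g
    neg {N} g = trans (sum-cong λ a → sym (-1*x≈-x (g a)))
      (trans (sym (*-distribˡ-sum (- 1#) g)) (-1*x≈-x (sum g)))

  Off : ∀ {N} → Subset N → Pred (Coeffs N) ℓ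
  Off S c = ∀ a → a ∉ S → c a ≈ 0#

  infixl 8 _↾_
  _↾_ : ∀ {N} → Coeffs N → Subset N → Coeffs N
  (c ↾ S) a = if does (a ∈? S) then c a else 0#

  ↾-on : ∀ {N} (c : Coeffs N) {S a} → a ∈ S → (c ↾ S) a ≈ c a
  ↾-on c {S} {a} a∈S with a ∈? S
  ... | yes _   = refl
  ... | no  a∉S = contradiction a∈S a∉S

  ↾-off : ∀ {N} (c : Coeffs N) S → Off S (c ↾ S)
  ↾-off c S a a∉S with a ∈? S
  ... | yes a∈S = contradiction a∈S a∉S
  ... | no  _   = refl

  inv : ∀ x → x ≉ 0# → Carrier
  inv x x≉0 = proj₁ (invertible x x≉0)

  inv-* : ∀ x x≉0 → inv x x≉0 * x ≈ 1#
  inv-* x x≉0 = proj₁ (proj₂ (invertible x x≉0))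

  -- Spans, independence and bases, read off from a space of relations.

  record IsSubspace {N ρ} (R : Pred (Coeffs N) ρ) : Set (c ⊔ ℓ ⊔ ρ) where
    field
      respects  : ∀ {c d} → (∀ a → c a ≈ d a) → R c → R d
      0-closed    : R (λ _ → 0#)
      +-closed   : ∀ {c d} → R c → R d → R (λ a → c a + d a)
      *-closed : ∀ s {c} → R c → R (λ a → s * c a)

    −-closed : ∀ {c d} → R c → R d → R (λ a → c a - d a)
    −-closed {c} {d} Rc Rd = respects (λ a → +-congˡ (-1*x≈-x (d a))) (+-closed Rc (*-closed (- 1#) Rd))

    combination : ∀ {k} (s : Coeffs k) (f : Fin k → Coeffs N) → (∀ i → R (f i)) →
                  R (λ a → sum (λ i → s i * f i a))
    combination {ℕ.zero}  s f Rf = 0-closed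
    combination {ℕ.suc k} s f Rf =
      +-closed (*-closed (s zero) (Rf zero)) (combination (s ∘ suc) (f ∘ suc) (Rf ∘ suc))

    -- As `s` is the sum of the `s a * δ a`, the difference is a combination of the relations
    -- `δ a - ν a`.
    substitute : ∀ (s : Coeffs N) (ν : Fin N → Coeffs N) →
                 (∀ a → R (λ b → δ a b - ν a b)) →
                 R (λ b → s b - sum (λ a → s a * ν a b))
    substitute s ν Rν = respects eq (combination s _ Rν)
      where
      eq : ∀ b → sum (λ a → s a * (δ a b - ν a b)) ≈ s b - sum (λ a → s a * ν a b)
      eq b = trans (sum-cong λ a → x[y-z]≈xy-xz (s a) (δ a b) (ν a b))
        (trans (sum-sub (λ a → s a * δ a b) (λ a → s a * ν a b)) (+-congʳ (sum-*δ s b)))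

  module _ {N ρ} (R : Pred (Coeffs N) ρ) where

    -- For `R` the relations of a family, this puts its member at `a` in the span of the members in
    -- `A`. Working with relations instead of vectors lets the same linear algebra serve families in
    -- coordinates and families of tensors.
    InSpan : Subset N → Fin N → Set (c ⊔ ℓ ⊔ ρ)
    InSpan A a = ∃ λ μ → Off A μ × R (λ b → δ a b - μ b)

    -- For `A` disjoint from `S`, independence of the members in `A` modulo the span of those in
    -- `S`; an empty `S` gives plain independence.
    IndepMod : Subset N → Subset N → Set (c ⊔ ℓ ⊔ ρ)
    IndepMod S A = ∀ {c} → R c → (∀ b → b ∉ S → b ∉ A → c b ≈ 0#) → ∀ {a} → a ∈ A → c a ≈ 0#

  module _ {N ρ} {R : Pred (Coeffs N) ρ} (isSubspace : IsSubspace R) where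
    open IsSubspace isSubspace

    self∈span : ∀ {A a} → a ∈ A → InSpan R A a
    self∈span {A} {a} a∈A = δ a , (λ b b∉A → δ-off {a = a} {b} λ { ≡.refl → b∉A a∈A }) ,
      respects (λ b → sym (-‿inverseʳ (δ a b))) 0-closed

    span-mono : ∀ {A B a} → A ⊆ B → InSpan R A a → InSpan R B a
    span-mono A⊆B (μ , off , Rμ) = μ , (λ b b∉B → off b (b∉B ∘ A⊆B)) , Rμ

    -- Extends the chosen expressions to all indices, so that `substitute` can sum over all of them;
    -- an index outside `T` stands for itself.
    representatives : ∀ {T A} → (∀ {t} → t ∈ T → InSpan R A t) →
      ∃ λ (ν : Fin N → Coeffs N) → (∀ t → R (λ b → δ t b - ν t b)) ×
        (∀ {t} → t ∈ T → Off A (ν t)) × (∀ {t} → t ∉ T → ∀ b → ν t b ≈ δ t b)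
    representatives {T} {A} T⊆ = (λ t → rep (t ∈? T)) , (λ t → rep-R (t ∈? T)) ,
      (λ {t} → rep-off (t ∈? T)) , λ {t} → rep-δ (t ∈? T)
      where
      rep : ∀ {t} → Dec (t ∈ T) → Coeffs N
      rep     (yes t∈T) = proj₁ (T⊆ t∈T)
      rep {t} (no  _)   = δ t

      rep-R : ∀ {t} (t∈?T : Dec (t ∈ T)) → R (λ b → δ t b - rep t∈?T b)
      rep-R     (yes t∈T) = proj₂ (proj₂ (T⊆ t∈T))
      rep-R {t} (no  _)   = respects (λ b → sym (-‿inverseʳ (δ t b))) 0-closed

      rep-off : ∀ {t} (t∈?T : Dec (t ∈ T)) → t ∈ T → Off A (rep t∈?T)
      rep-off (yes t∈T) _   = proj₁ (proj₂ (T⊆ t∈T))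
      rep-off (no  t∉T) t∈T = contradiction t∈T t∉T

      rep-δ : ∀ {t} (t∈?T : Dec (t ∈ T)) → t ∉ T → ∀ b → rep t∈?T b ≈ δ t b
      rep-δ (yes t∈T) t∉T b = contradiction t∈T t∉T
      rep-δ (no  _)   _   b = refl

    change-span : ∀ {T A μ} → Off T μ → (∀ {t} → t ∈ T → InSpan R A t) →
                  ∃ λ ν → Off A ν × R (λ b → μ b - ν b)
    change-span {T} {A} {μ} μ-off T⊆ =
      let ν , Rν , ν-off , _ = representatives T⊆ in
      (λ b → sum λ t → μ t * ν t b) ,
      (λ b b∉A → sum-zero λ t → [ (λ t∈T → x*0 (μ t) (ν-off t∈T b b∉A)) , 0*x (ν t b) ∘ μ-off t ]′
        (toSum (t ∈? T))) ,
      substitute μ ν Rν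

    span-trans : ∀ {T A a} → InSpan R T a → (∀ {t} → t ∈ T → InSpan R A t) → InSpan R A a
    span-trans {a = a} (μ , μ-off , Rμ) T⊆ =
      let ν , ν-off , Rν = change-span μ-off T⊆ in
      ν , ν-off , respects (λ b → [x-y]+[y-z]≈x-z (δ a b) (μ b) (ν b)) (+-closed Rμ Rν)

    -- Divide the relation by its coefficient at `d` and solve for the member at `d`.
    pivot : ∀ {T d c} → R c → c d ≉ 0# → (∀ b → b ∉ T → b ≢ d → c b ≈ 0#) → InSpan R T d
    pivot {T} {d} {c} Rc cd≉0 off = (λ b → δ d b - s * c b) , off′ ,
      respects (λ b → sym (x-[x-y]≈y (δ d b) (s * c b))) (*-closed s Rc)
      where
      s = inv (c d) cd≉0
      off′ : Off T (λ b → δ d b - s * c b)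
      off′ b b∉T with b ≟ d
      ... | yes ≡.refl = x-x≈0 (trans (δ-diag d) (sym (inv-* (c d) cd≉0)))
      ... | no  b≢d    = x-x≈0 (trans (δ-off (b≢d ∘ ≡.sym)) (sym (x*0 s (off b b∉T b≢d))))

    module _ (em : ExcludedMiddle (c ⊔ ℓ ⊔ ρ)) where
      private
        ≈0? : ∀ x → Dec (x ≈ 0#)
        ≈0? x = lower-em (c ⊔ ρ) em

      -- A relation that is non-zero at `d` could be solved for `d`. So it vanishes at `d`, and the
      -- independence of `A` applies.
      indepMod-∪ : ∀ {S A d} → IndepMod R S A → ¬ InSpan R (S ∪ A) d → IndepMod R S (A ∪ ⁅ d ⁆)
      indepMod-∪ {S} {A} {d} ind d∉ {c} Rc off {a} a∈ with ≈0? (c d)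
      ... | no cd≉0 = contradiction (pivot Rc cd≉0 λ b b∉ b≢d → off b (b∉ ∘ x∈p∪q⁺ ∘ inj₁)
                        ([ b∉ ∘ x∈p∪q⁺ ∘ inj₂ , b≢d ∘ x∈⁅y⁆⇒x≡y d ]′ ∘ x∈p∪q⁻ A ⁅ d ⁆)) d∉
      ... | yes cd≈0 with x∈p∪q⁻ A ⁅ d ⁆ a∈
      ...   | inj₂ a∈d rewrite x∈⁅y⁆⇒x≡y d a∈d = cd≈0
      ...   | inj₁ a∈A = ind Rc off′ a∈A
        where
        off′ : ∀ b → b ∉ S → b ∉ A → c b ≈ 0#
        off′ b b∉S b∉A with b ≟ d
        ... | yes ≡.refl = cd≈0
        ... | no  b≢d    = off b b∉S ([ b∉A , b≢d ∘ x∈⁅y⁆⇒x≡y d ]′ ∘ x∈p∪q⁻ A ⁅ d ⁆)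

      -- Greedy choice: while some `d` in `D` is outside the span of `S ∪ A`, adding it to `A` keeps
      -- independence.
      relative-basis : ∀ S D → ∃ λ A → A ⊆ D × IndepMod R S A × (∀ {d} → d ∈ D → InSpan R (S ∪ A) d)
      relative-basis S D = go ∣ D ∣ ⊥ (⊥-elim ∘ ∉⊥) (ℕ.m≤m+n _ _) (λ _ _ a∈⊥ → contradiction a∈⊥ ∉⊥)
        where
        go : ∀ k A → A ⊆ D → ∣ D ∣ ≤ k ℕ.+ ∣ A ∣ → IndepMod R S A →
             ∃ λ A → A ⊆ D × IndepMod R S A × (∀ {d} → d ∈ D → InSpan R (S ∪ A) d)
        -- The fuel bounds the number of elements of `D` not yet chosen; with none left, `A` is all
        -- of `D`.
        go ℕ.zero A A⊆D ∣D∣≤ ind =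
          A , A⊆D , ind , λ d∈D → self∈span (x∈p∪q⁺ (inj₂ (p⊆q∧∣q∣≤∣p∣⇒q⊆p A⊆D ∣D∣≤ d∈D)))
        go (ℕ.suc k) A A⊆D ∣D∣≤ ind with any? (λ d → (d ∈? D) ×-dec ¬? (em {InSpan R (S ∪ A) d}))
        ... | no ¬any = A , A⊆D , ind , λ d∈D → decidable-stable em λ d∉ → ¬any (_ , d∈D , d∉)
        ... | yes (d , d∈D , d∉) = go k (A ∪ ⁅ d ⁆)
          ([ A⊆D , (λ x∈d → ≡.subst (_∈ D) (≡.sym (x∈⁅y⁆⇒x≡y d x∈d)) d∈D) ]′ ∘ x∈p∪q⁻ A ⁅ d ⁆)
          (ℕ.≤-trans ∣D∣≤ (ℕ.≤-trans (ℕ.≤-reflexive (≡.sym (ℕ.+-suc k ∣ A ∣)))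
            (ℕ.+-monoʳ-≤ k (p⊂q⇒∣p∣<∣q∣ (p⊆p∪q ⁅ d ⁆ ,
              d , x∈p∪q⁺ (inj₂ (x∈⁅x⁆ d)) , λ d∈A → d∉ (self∈span (x∈p∪q⁺ (inj₂ d∈A))))))))
          (indepMod-∪ ind d∉)

      dependent⇒redundant : ∀ {S A} → ¬ IndepMod R S A → ∃ λ b → b ∈ A × InSpan R (S ∪ (A ∖ b)) b
      dependent⇒redundant {S} {A} ¬ind with em {∃ λ b → b ∈ A × InSpan R (S ∪ (A ∖ b)) b}
      ... | yes p = p
      ... | no ¬p = ⊥-elim (¬ind
        λ Rc off {a} a∈A → decidable-stable (≈0? _) λ ca≉0 → ¬p (a , a∈A ,
          pivot Rc ca≉0 λ b b∉ b≢a → off b (b∉ ∘ x∈p∪q⁺ ∘ inj₁)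
            (λ b∈A → b∉ (x∈p∪q⁺ (inj₂ (x∈p∧x≢y⇒x∈p-y b∈A b≢a))))))

-- Gaussian elimination and families given by coordinates.

module LinearFamilies {c ℓ} (F : Field c ℓ) (em : ExcludedMiddle (c ⊔ ℓ)) where
  open Coefficients F
  open import Relation.Binary.Reasoning.Setoid setoid

  ≈0? : ∀ x → Dec (x ≈ 0#)
  ≈0? x = lower-em c em

  -- Gaussian elimination, one column at a time. A column outside `A`, or zero in all rows of `C`,
  -- is dropped. Otherwise a row `p` that is non-zero there clears the column, and one row and one
  -- column fewer remain.
  linear-dependence :
    ∀ {M N} (C : Subset M) (A : Subset N) (m : Fin M → Coeffs N) →
    (∀ {j} → j ∈ C → Off A (m j)) → ∣ A ∣ < ∣ C ∣ →
    ∃ λ μ → Off C μ × (∃ λ j → μ j ≉ 0#) × ∀ b → sum (λ j → μ j * m j b) ≈ 0#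
  drop-column :
    ∀ {M N} (C : Subset M) (A : Subset N) (m : Fin M → Coeffs (ℕ.suc N)) →
    (∀ {j} → j ∈ C → m j zero ≈ 0#) → (∀ {j} → j ∈ C → Off A (m j ∘ suc)) → ∣ A ∣ < ∣ C ∣ →
    ∃ λ μ → Off C μ × (∃ λ j → μ j ≉ 0#) × ∀ b → sum (λ j → μ j * m j b) ≈ 0#

  linear-dependence C [] m off ∣A∣<∣C∣ =
    let j , j∈C = 0<∣p∣⇒nonempty C ∣A∣<∣C∣ in
    δ j , (λ i i∉C → δ-off {a = j} {i} λ { ≡.refl → i∉C j∈C }) ,
    (j , λ δ≈0 → 1≉0 (trans (sym (δ-diag j)) δ≈0)) , λ ()
  linear-dependence C (outside ∷ A) m off ∣A∣<∣C∣ =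
    drop-column C A m (λ j∈C → off j∈C zero λ ())
      (λ j∈C b b∉A → off j∈C (suc b) λ { (there b∈A) → b∉A b∈A }) ∣A∣<∣C∣
  linear-dependence C (inside ∷ A) m off ∣A∣<∣C∣
    with any? (λ j → (j ∈? C) ×-dec ¬? (≈0? (m j zero)))
  ... | no ¬any = drop-column C A m
      (λ j∈C → decidable-stable (≈0? _) λ mj0≉0 → ¬any (_ , j∈C , mj0≉0))
      (λ j∈C b b∉A → off j∈C (suc b) λ { (there b∈A) → b∉A b∈A }) (ℕ.<-trans ℕ.≤-refl ∣A∣<∣C∣)
  ... | yes (p , p∈C , mp0≉0) =
    let μ , μ-off , (j , μj≉0) , μ-sum = linear-dependence (C ∖ p) A (λ j b → m′ j (suc b)) off′
          (ℕ.s≤s⁻¹ (ℕ.≤-trans ∣A∣<∣C∣ (∣p∣≤1+∣p-x∣ C p)))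
        t = sum (λ j → μ j * (m j zero * s))
        j∈C∖p = decidable-stable (j ∈? (C ∖ p)) λ j∉ → μj≉0 (μ-off j j∉)
        j≢p = x∈p-y⇒x≢y C j∈C∖p
    in
    -- `μ` is a dependence of the cleared rows. Collecting the multiples of row `p` that were
    -- subtracted gives row `p` the coefficient `- t`.
    (λ j → μ j + (- t) * δ p j) ,
    (λ i i∉C → trans (+-cong (μ-off i (i∉C ∘ p─q⊆p C ⁅ p ⁆))
                 (x*0 (- t) (δ-off {a = p} {i} λ { ≡.refl → i∉C p∈C }))) (+-identityˡ 0#)) ,
    (j , λ eq → μj≉0 (trans (sym (trans (+-congˡ (x*0 (- t) (δ-off (j≢p ∘ ≡.sym)))) (+-identityʳ _))) eq)) ,
    λ b → trans (update μ t b) (trans (sym (expand μ b)) (all-columns μ μ-sum b))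
    where
    s = inv (m p zero) mp0≉0

    m′ : _ → _ → Carrier
    m′ j b = m j b - (m j zero * s) * m p b

    update : ∀ μ t b → sum (λ j → (μ j + (- t) * δ p j) * m j b) ≈ sum (λ j → μ j * m j b) - t * m p b
    update μ t b = begin
      sum (λ j → (μ j + (- t) * δ p j) * m j b)
        ≈⟨ sum-cong (λ j → trans (distribʳ (m j b) (μ j) _) (+-congˡ (*-assoc (- t) (δ p j) (m j b)))) ⟩
      sum (λ j → μ j * m j b + (- t) * (δ p j * m j b))
        ≈⟨ ∑-distrib-+ (λ j → μ j * m j b) (λ j → (- t) * (δ p j * m j b)) ⟩
      sum (λ j → μ j * m j b) + sum (λ j → (- t) * (δ p j * m j b))
        ≈⟨ +-congˡ (*-distribˡ-sum (- t) (λ j → δ p j * m j b)) ⟨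
      sum (λ j → μ j * m j b) + (- t) * sum (λ j → δ p j * m j b)
        ≈⟨ +-congˡ (trans (*-congˡ (sum-δ* p λ j → m j b)) (sym (-‿distribˡ-* t (m p b)))) ⟩
      sum (λ j → μ j * m j b) - t * m p b ∎

    m′-zero : ∀ j → m′ j zero ≈ 0#
    m′-zero j = x-x≈0 (sym (trans (*-assoc _ s _)
      (trans (*-congˡ (inv-* _ mp0≉0)) (*-identityʳ _))))

    off′ : ∀ {j} → j ∈ C ∖ p → Off A (λ b → m′ j (suc b))
    off′ j∈ b b∉A = x-x≈0 (trans (off (p─q⊆p C ⁅ p ⁆ j∈) (suc b) b∉′)
      (sym (x*0 _ (off p∈C (suc b) b∉′))))
      where
      b∉′ : suc b ∉ inside ∷ A
      b∉′ (there b∈A) = b∉A b∈A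

    expand : ∀ μ b → sum (λ j → μ j * m′ j b) ≈
             sum (λ j → μ j * m j b) - sum (λ j → μ j * (m j zero * s)) * m p b
    expand μ b = begin
      sum (λ j → μ j * m′ j b)
        ≈⟨ sum-cong (λ j → trans (x[y-z]≈xy-xz (μ j) (m j b) _) (+-congˡ (-‿cong (sym (*-assoc (μ j) _ _))))) ⟩
      sum (λ j → μ j * m j b - (μ j * (m j zero * s)) * m p b)
        ≈⟨ sum-sub (λ j → μ j * m j b) (λ j → (μ j * (m j zero * s)) * m p b) ⟩
      sum (λ j → μ j * m j b) - sum (λ j → (μ j * (m j zero * s)) * m p b)
        ≈⟨ +-congˡ (-‿cong (*-distribʳ-sum (m p b) (λ j → μ j * (m j zero * s)))) ⟨
      sum (λ j → μ j * m j b) - sum (λ j → μ j * (m j zero * s)) * m p b ∎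

    all-columns : ∀ μ → (∀ b → sum (λ j → μ j * m′ j (suc b)) ≈ 0#) →
                  ∀ b → sum (λ j → μ j * m′ j b) ≈ 0#
    all-columns μ μ-sum zero    = sum-zero λ j → x*0 (μ j) (m′-zero j)
    all-columns μ μ-sum (suc b) = μ-sum b

  drop-column C A m m0≈0 off ∣A∣<∣C∣ =
    let μ , μ-off , nz , μ-sum = linear-dependence C A (λ j → m j ∘ suc) off ∣A∣<∣C∣ in
    μ , μ-off , nz , λ where
      zero    → sum-zero λ j → column μ μ-off j
      (suc b) → μ-sum b
    where
    column : ∀ μ → Off C μ → ∀ j → μ j * m j zero ≈ 0#
    column μ μ-off j with j ∈? C
    ... | yes j∈C = x*0 (μ j) (m0≈0 j∈C)
    ... | no  j∉C = 0*x (m j zero) (μ-off j j∉C)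

  -- If `C` were larger, the expressions `ν` of its members through `A` would have a linear
  -- dependence `μ`. Substituting `ν` in `μ` gives zero, so `μ` is itself a relation, against the
  -- independence of `C`.
  steinitz : ∀ {N ρ} {R : Pred (Coeffs N) ρ} → IsSubspace R → ∀ {C A} →
             IndepMod R ⊥ C → (∀ {d} → d ∈ C → InSpan R A d) → ∣ C ∣ ≤ ∣ A ∣
  steinitz {N} {R = R} isSub {C} {A} ind span with ∣ C ∣ ℕ.≤? ∣ A ∣
  ... | yes ≤ = ≤
  ... | no ≰ =
    let ν , Rν , ν-off , _ = representatives isSub span
        μ , μ-off , (j , μj≉0) , μ-sum = linear-dependence C A ν ν-off (ℕ.≰⇒> ≰)
        j∈C = decidable-stable (j ∈? C) λ j∉C → μj≉0 (μ-off j j∉C)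
        Rμ = respects (λ b → trans (+-congˡ (trans (-‿cong (μ-sum b)) -0#≈0#)) (+-identityʳ _))
               (substitute μ ν Rν)
    in contradiction (ind Rμ (λ b _ → μ-off b) j∈C) μj≉0
    where open IsSubspace isSub

  Null : ∀ {N} {K : Set} → (Fin N → K → Carrier) → Pred (Coeffs N) ℓ
  Null X c = ∀ k → sum (λ a → c a * X a k) ≈ 0#

  Null-isSubspace : ∀ {N} {K : Set} (X : Fin N → K → Carrier) → IsSubspace (Null X)
  Null-isSubspace X = record
    { respects = λ c≈d Xc k → trans (sum-cong λ a → *-congʳ {X a k} (sym (c≈d a))) (Xc k)
    ; 0-closed = λ k → sum-zero λ a → zeroˡ (X a k)
    ; +-closed = λ {c} {d} Xc Xd k → trans (sum-cong λ a → distribʳ (X a k) (c a) (d a))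
        (trans (∑-distrib-+ (λ a → c a * X a k) (λ a → d a * X a k))
          (trans (+-cong (Xc k) (Xd k)) (+-identityˡ 0#)))
    ; *-closed = λ s {c} Xc k → trans (sum-cong λ a → *-assoc s (c a) (X a k))
        (trans (sym (*-distribˡ-sum s λ a → c a * X a k)) (x*0 s (Xc k)))
    }

  -- `X a` expresses the member at `a` through a basis `A`. The image of a relation under `X` is a
  -- relation supported on `A`, hence zero; conversely `s` differs from its image by a relation.
  -- Abstract spaces are thus replaced by coordinates, where tensors become products of entries.
  coordinates : ∀ {N ρ} {R : Pred (Coeffs N) ρ} → IsSubspace R → ExcludedMiddle (c ⊔ ℓ ⊔ ρ) →
    ∃ λ (X : Fin N → Fin N → Carrier) → (∀ a → R (λ b → δ a b - X a b)) ×
      (∀ {s} → R s → Null X s) × (∀ {s} → Null X s → R s)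
  coordinates {N} {R = R} isSub em′ = X , RX , null , relation
    where
    open IsSubspace isSub
    basis = relative-basis isSub em′ ⊥ ⊤
    A = proj₁ basis
    A-indep : IndepMod R ⊥ A
    A-indep = proj₁ (proj₂ (proj₂ basis))
    A-spans : ∀ a → InSpan R (⊥ ∪ A) a
    A-spans a = proj₂ (proj₂ (proj₂ basis)) {a} ∈⊤
    X : Fin N → Fin N → Carrier
    X a = proj₁ (A-spans a)
    RX : ∀ a → R (λ b → δ a b - X a b)
    RX a = proj₂ (proj₂ (A-spans a))
    null : ∀ {s} → R s → Null X s
    null {s} Rs k = [ A-indep R-image (λ b _ → off b) , off k ]′ (toSum (k ∈? A))
      where
      off : Off A (λ b → sum λ a → s a * X a b)
      off b b∉A = sum-zero λ a → x*0 (s a)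
        (proj₁ (proj₂ (A-spans a)) b ([ ∉⊥ , b∉A ]′ ∘ x∈p∪q⁻ ⊥ A))
      R-image : R (λ b → sum λ a → s a * X a b)
      R-image = respects (λ b → x-[x-y]≈y (s b) _) (−-closed Rs (substitute s X RX))
    relation : ∀ {s} → Null X s → R s
    relation {s} Xs = respects
      (λ b → trans (+-congˡ (trans (-‿cong (Xs b)) -0#≈0#)) (+-identityʳ (s b))) (substitute s X RX)

  -- Tensor products of two families.

  infixr 7 _⊠_
  -- The member-wise tensor product in coordinates, that is, the row-wise Khatri-Rao product of two
  -- matrices.
  _⊠_ : ∀ {N} {K L : Set} → (Fin N → K → Carrier) → (Fin N → L → Carrier) → Fin N → K × L → Carrier
  (X ⊠ Y) a (k , l) = X a k * Y a l

  module _ {N} {K L : Set} (X : Fin N → K → Carrier) (Y : Fin N → L → Carrier) where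
    private
      module X = IsSubspace (Null-isSubspace X)
      module Y = IsSubspace (Null-isSubspace Y)
      NX = Null X
      NY = Null Y
      NZ = Null (X ⊠ Y)

    -- Apply the coordinate functional at `l` to the second tensor factor of the relation.
    ⊠-nullˡ : ∀ {c} → NZ c → ∀ l → NX (λ a → c a * Y a l)
    ⊠-nullˡ {c} Zc l k = trans
      (sum-cong λ a → trans (*-assoc (c a) (Y a l) (X a k)) (*-congˡ (*-comm (Y a l) (X a k)))) (Zc (k , l))

    ⊠-nullʳ : ∀ {c} → NZ c → ∀ k → NY (λ a → c a * X a k)
    ⊠-nullʳ {c} Zc k l = trans (sum-cong λ a → *-assoc (c a) (X a k) (Y a l)) (Zc (k , l))

    -- Let c be a relation of Z = X ⊗ Y supported on S ∪ D, non-zero on D, and A ⊆ D a basis of X_D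
    -- modulo X_S.  Taking the coordinate of c at a ∈ A expresses Y_a through Y_{D∖A}, so D∖A spans
    -- Y_D.  Eliminating the X_b with b ∈ D∖A would turn c ↾ S into a relation if Y_{D∖A} were
    -- independent modulo Y_S; hence one more element of D∖A is redundant.
    module Factor {S D : Subset N} {c : Coeffs N} (Zc : NZ c) (¬Zc↾S : ¬ NZ (c ↾ S))
      (c-off : ∀ b → b ∉ S → b ∉ D → c b ≈ 0#)
      (c≉0 : ∀ {d} → d ∈ D → c d ≉ 0#) (D∩S : ∀ {d} → d ∈ D → d ∉ S)
      {A : Subset N} (A⊆D : A ⊆ D) (A-indep : IndepMod NX S A)
      (A-spans : ∀ {d} → d ∈ D → InSpan NX (S ∪ A) d) where

      private
        reps = representatives (Null-isSubspace X) {T = D ─ A} (A-spans ∘ p─q⊆p D A)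
        ν = proj₁ reps
        Rν = proj₁ (proj₂ reps)
        ν-off : ∀ {b} → b ∈ D ─ A → Off (S ∪ A) (ν b)
        ν-off = proj₁ (proj₂ (proj₂ reps))
        ν-δ : ∀ {b} → b ∉ D ─ A → ∀ a → ν b a ≈ δ b a
        ν-δ = proj₂ (proj₂ (proj₂ reps))

        A∩D─A : ∀ {a} → a ∈ A → a ∉ D ─ A
        A∩D─A a∈A a∈D─A = x∈p─q⇒x∉q D A a∈D─A a∈A

        coordinate-null : ∀ {a} → a ∈ A → NY (λ b → c b * ν b a)
        coordinate-null {a} a∈A l = trans (sum-cong λ b → swap (c b) (ν b a) (Y b l))
          (A-indep {c = g} Xg g-off a∈A)
          where
          swap : ∀ x y z → (x * y) * z ≈ (x * z) * y
          swap x y z = trans (*-assoc x y z) (trans (*-congˡ (*-comm y z)) (sym (*-assoc x z y)))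
          -- `g` is the relation `c b * Y b l` of `X` with the members in `D ─ A` rewritten through
          -- `S ∪ A`. Being supported on `S ∪ A`, it vanishes on `A`.
          g : Coeffs N
          g a = sum (λ b → (c b * Y b l) * ν b a)
          Xg : NX g
          Xg = X.respects (λ a → x-[x-y]≈y (c a * Y a l) (g a))
            (X.−-closed (⊠-nullˡ Zc l) (X.substitute (λ b → c b * Y b l) ν Rν))
          g-off : ∀ a → a ∉ S → a ∉ A → g a ≈ 0#
          g-off a a∉S a∉A = sum-zero term
            where
            outside-D─A : ∀ b → b ∉ D ─ A → (c b * Y b l) * ν b a ≈ 0#
            outside-D─A b b∉ with b ≟ a
            ... | no  b≢a    = x*0 _ (trans (ν-δ b∉ a) (δ-off b≢a))
            ... | yes ≡.refl = 0*x _ (0*x _ (c-off a a∉S λ a∈D → b∉ (x∈p∧x∉q⇒x∈p─q a∈D a∉A)))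
            term : ∀ b → (c b * Y b l) * ν b a ≈ 0#
            term b = [ (λ b∈ → x*0 _ (ν-off b∈ a ([ a∉S , a∉A ]′ ∘ x∈p∪q⁻ S A))) , outside-D─A b ]′
              (toSum (b ∈? (D ─ A)))

        A∈span : ∀ {a} → a ∈ A → InSpan NY (D ─ A) a
        A∈span {a} a∈A = pivot (Null-isSubspace Y) (coordinate-null a∈A)
          (λ eq → c≉0 (A⊆D a∈A) (trans (sym (trans (*-congˡ (trans (ν-δ (A∩D─A a∈A) a) (δ-diag a)))
            (*-identityʳ _))) eq))
          λ b b∉ b≢a → x*0 (c b) (trans (ν-δ b∉ a) (δ-off b≢a))

        D∈span : ∀ {d} → d ∈ D → InSpan NY (D ─ A) d
        D∈span {d} d∈D with d ∈? A
        ... | yes d∈A = A∈span d∈A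
        ... | no  d∉A = self∈span (Null-isSubspace Y) (x∈p∧x∉q⇒x∈p─q d∈D d∉A)

        D─A-dependent : ¬ IndepMod NY S (D ─ A)
        D─A-dependent ind = ¬Zc↾S λ (k , l) → trans
          (sum-cong λ b → trans (sym (*-assoc _ _ _)) (*-congʳ (sym (h≈c↾S k b)))) (Yh k l)
          where
          XA : K → Coeffs N
          XA k = (λ a → X a k) ↾ A
          -- On `S` the subtracted sum is zero, since `ν b` is `δ b` and `A` misses `S`; on `A` it
          -- cancels `c b * X b k`. Outside `S` only `D ─ A` is left, where the assumed independence
          -- makes `h k` vanish.
          h : K → Coeffs N
          h k b = c b * X b k - sum (λ a → XA k a * (c b * ν b a))
          Yh : ∀ k → NY (h k)
          Yh k = Y.−-closed (⊠-nullʳ Zc k)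
            (Y.respects (λ b → sum-cong λ a → agree a b) (Y.combination (XA k) v Yv))
            where
            -- `coordinate-null` holds on `A` only, so other rows are set to zero; their weights
            -- `XA k a` are zero as well.
            v : Fin N → Coeffs N
            v a with a ∈? A
            ... | yes _ = λ b → c b * ν b a
            ... | no  _ = λ _ → 0#
            Yv : ∀ a → NY (v a)
            Yv a with a ∈? A
            ... | yes a∈A = coordinate-null a∈A
            ... | no  _   = Y.0-closed
            agree : ∀ a b → XA k a * v a b ≈ XA k a * (c b * ν b a)
            agree a b with a ∈? A
            ... | yes _ = refl
            ... | no  _ = trans (zeroˡ _) (sym (zeroˡ _))
          h-on : ∀ k b → b ∉ D ─ A → h k b ≈ c b * X b k - c b * XA k b
          h-on k b b∉ = +-congˡ (-‿cong (trans (sum-cong λ a →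
              trans (*-congˡ (trans (*-comm _ _) (*-congʳ (ν-δ b∉ a)))) (trans (*-comm _ _) (*-assoc _ _ _)))
            (sum-δ* b (λ a → c b * XA k a))))
          h-off : ∀ k b → b ∉ S → b ∉ D ─ A → h k b ≈ 0#
          h-off k b b∉S b∉ with b ∈? A
          ... | yes b∈A = trans (h-on k b b∉) (x-x≈0 (*-congˡ (sym (↾-on (λ a → X a k) b∈A))))
          ... | no  b∉A = trans (h-on k b b∉) (x-x≈0 (trans (0*x _ cb≈0) (sym (0*x _ cb≈0))))
            where cb≈0 = c-off b b∉S λ b∈D → b∉ (x∈p∧x∉q⇒x∈p─q b∈D b∉A)
          h≈c↾S : ∀ k b → h k b ≈ (c ↾ S) b * X b k
          h≈c↾S k b with b ∈? S
          ... | yes b∈S = trans (h-on k b λ b∈ → D∩S (p─q⊆p D A b∈) b∈S)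
              (trans (+-congˡ (trans (-‿cong (x*0 (c b) (↾-off (λ a → X a k) A b λ b∈A → D∩S (A⊆D b∈A) b∈S)))
                -0#≈0#)) (+-identityʳ _))
          ... | no b∉S = trans h≈0 (sym (zeroˡ _))
            where
            h≈0 : h k b ≈ 0#
            h≈0 = [ ind (Yh k) (h-off k) , h-off k b b∉S ]′ (toSum (b ∈? (D ─ A)))

      complement : ∃ λ B → ∣ A ∣ ℕ.+ ∣ B ∣ < ∣ D ∣ × (∀ {d} → d ∈ D → InSpan NY (S ∪ B) d)
      complement =
        let b , b∈ , b∈span = dependent⇒redundant (Null-isSubspace Y) em D─A-dependent in
        ((D ─ A) ∖ b) ,
        ℕ.≤-trans (ℕ.+-monoʳ-< ∣ A ∣ (x∈p⇒∣p-x∣<∣p∣ b∈))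
          (ℕ.≤-trans (ℕ.≤-reflexive (ℕ.+-comm ∣ A ∣ _)) (∣p─q∣+∣q∣≤∣p∣ A⊆D)) ,
        λ {d} d∈D → span-trans (Null-isSubspace Y) {a = d} (D∈span d∈D) (others b b∈span)
        where
        others : ∀ b → InSpan NY (S ∪ ((D ─ A) ∖ b)) b →
                 ∀ {t} → t ∈ D ─ A → InSpan NY (S ∪ ((D ─ A) ∖ b)) t
        others b b∈span {t} t∈ with t ≟ b
        ... | yes ≡.refl = b∈span
        ... | no  t≢b    = self∈span (Null-isSubspace Y) (x∈p∪q⁺ (inj₂ (x∈p∧x≢y⇒x∈p-y t∈ t≢b)))

-- Connected families and the dimension bound by ears.

module Connectivity {c ℓ} (F : Field c ℓ) (em : ExcludedMiddle (c ⊔ ℓ)) where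
  open Coefficients F
  open LinearFamilies F em

  private
    em-ℓ : ExcludedMiddle ℓ
    em-ℓ = lower-em c em

  -- The span of `G` is the direct sum of the spans of `S` and of its complement in `G` exactly when
  -- every relation on `G` restricts to a relation on `S`. Excluding this for all proper `S` is
  -- connectedness of the linear matroid.
  Connected : ∀ {N ρ} → Subset N → Pred (Coeffs N) ρ → Set (c ⊔ ℓ ⊔ ρ)
  Connected G R = ∀ {S} → S ⊆ G → Nonempty S → ¬ (G ⊆ S) → ∃ λ c → R c × Off G c × ¬ R (c ↾ S)

  module _ {N} {R : Pred (Coeffs N) ℓ} (isSubspace : IsSubspace R) where
    open IsSubspace isSubspace

    singleton-indep : ∀ {a} → ¬ R (δ a) → IndepMod R ⊥ ⁅ a ⁆
    singleton-indep {a} ¬Rδ {c} Rc off {b} b∈ with x∈⁅y⁆⇒x≡y a b∈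
    ... | ≡.refl = decidable-stable (≈0? (c a)) λ ca≉0 →
      ¬Rδ (respects (λ b → δ≈ ca≉0 b) (*-closed (inv (c a) ca≉0) Rc))
      where
      δ≈ : ∀ ca≉0 b → inv (c a) ca≉0 * c b ≈ δ a b
      δ≈ ca≉0 b with a ≟ b
      ... | yes ≡.refl = inv-* (c a) ca≉0
      ... | no  a≢b    = x*0 _ (off b ∉⊥ (a≢b ∘ ≡.sym ∘ x∈⁅y⁆⇒x≡y a))

    span-extend : ∀ {S D P A} → (∀ {s} → s ∈ S → InSpan R P s) →
                  (∀ {d} → d ∈ D → InSpan R (S ∪ A) d) →
                  ∀ {x} → x ∈ S ∪ D → InSpan R (P ∪ A) x
    span-extend {S} {D} {P} {A} S∈ D∈ {x} x∈ =
      [ (λ x∈S → S∈′ x∈S) , (λ x∈D → span-trans isSubspace {a = x} (D∈ x∈D) S∪A∈) ]′ (x∈p∪q⁻ S D x∈)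
      where
      S∈′ : ∀ {s} → s ∈ S → InSpan R (P ∪ A) s
      S∈′ {s} s∈S = span-mono isSubspace {a = s} (p⊆p∪q A) (S∈ s∈S)
      S∪A∈ : ∀ {t} → t ∈ S ∪ A → InSpan R (P ∪ A) t
      S∪A∈ t∈ = [ S∈′ , (λ t∈A → self∈span isSubspace (x∈p∪q⁺ (inj₂ t∈A))) ]′ (x∈p∪q⁻ S A t∈)

    Crosses : Subset N → Subset N → Set (c ⊔ ℓ)
    Crosses S D = ∃ λ c → R c × ¬ R (c ↾ S) × (∀ b → b ∉ S → b ∉ D → c b ≈ 0#)

    -- Delete single elements as long as the set still crosses. Minimality under single deletions is
    -- the form that `Minimal` works with.
    minimal-crossing : ∀ {S} D → Crosses S D →
      ∃ λ D′ → D′ ⊆ D × Crosses S D′ × (∀ {d} → d ∈ D′ → ¬ Crosses S (D′ ∖ d))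
    minimal-crossing {S} D = go ∣ D ∣ D ℕ.≤-refl
      where
      go : ∀ k D → ∣ D ∣ ≤ k → Crosses S D →
           ∃ λ D′ → D′ ⊆ D × Crosses S D′ × (∀ {d} → d ∈ D′ → ¬ Crosses S (D′ ∖ d))
      go k D ∣D∣≤k cross with any? (λ d → (d ∈? D) ×-dec em {Crosses S (D ∖ d)})
      ... | no  ¬any = D , id , cross , λ d∈D cross′ → ¬any (_ , d∈D , cross′)
      go ℕ.zero D ∣D∣≤k cross | yes (d , d∈D , cross′) =
        contradiction (ℕ.≤-trans (x∈p⇒∣p-x∣<∣p∣ d∈D) ∣D∣≤k) λ ()
      go (ℕ.suc k) D ∣D∣≤k cross | yes (d , d∈D , cross′) =
        let D′ , D′⊆ , rest = go k (D ∖ d) (ℕ.s≤s⁻¹ (ℕ.≤-trans (x∈p⇒∣p-x∣<∣p∣ d∈D) ∣D∣≤k)) cross′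
        in D′ , p─q⊆p D ⁅ d ⁆ ∘ D′⊆ , rest

    module Minimal {S D : Subset N} {c : Coeffs N} (Rc : R c) (¬Rc↾S : ¬ R (c ↾ S))
      (off : ∀ b → b ∉ S → b ∉ D → c b ≈ 0#) (min : ∀ {d} → d ∈ D → ¬ Crosses S (D ∖ d)) where

      nonzero : ∀ {d} → d ∈ D → c d ≉ 0#
      nonzero {d} d∈D cd≈0 = min d∈D (c , Rc , ¬Rc↾S , off′)
        where
        off′ : ∀ b → b ∉ S → b ∉ D ∖ d → c b ≈ 0#
        off′ b b∉S b∉ with b ≟ d
        ... | yes ≡.refl = cd≈0
        ... | no  b≢d    = off b b∉S λ b∈D → b∉ (x∈p∧x≢y⇒x∈p-y b∈D b≢d)

      nonempty : Nonempty D
      nonempty with nonempty? D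
      ... | yes ne  = ne
      ... | no  ¬ne = contradiction (respects c≈c↾S Rc) ¬Rc↾S
        where
        c≈c↾S : ∀ b → c b ≈ (c ↾ S) b
        c≈c↾S b with b ∈? S
        ... | yes _   = refl
        ... | no  b∉S = off b b∉S λ b∈D → ¬ne (b , b∈D)

      -- Let a relation `e` on `S` and the rest of `D` be non-zero at `a`. If `e ↾ S` is no
      -- relation, `e` crosses without using `d`. If it is one, subtracting a multiple of `e` from
      -- `c` clears `a` and still crosses. Both contradict minimality.
      indep : ∀ {d} → d ∈ D → IndepMod R S (D ∖ d)
      indep {d} d∈D {e} Re e-off {a} a∈ = decidable-stable (≈0? (e a)) (case em-ℓ)
        where
        case : Dec (R (e ↾ S)) → ¬ (e a ≉ 0#)
        case (no ¬Re↾S) _ = min d∈D (e , Re , ¬Re↾S , e-off)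
        case (yes Re↾S) ea≉0 = min (p─q⊆p D ⁅ d ⁆ a∈)
          (c′ , −-closed Rc (*-closed t Re) ,
           (λ Rc′ → ¬Rc↾S (respects c↾S≈ (+-closed Rc′ (*-closed t Re↾S)))) , off′)
          where
          t = c a * inv (e a) ea≉0
          c′ : Coeffs N
          c′ b = c b - t * e b
          c↾S≈ : ∀ b → (c′ ↾ S) b + t * (e ↾ S) b ≈ (c ↾ S) b
          c↾S≈ b with b ∈? S
          ... | yes _ = trans (+-assoc _ _ _) (trans (+-congˡ (-‿inverseˡ _)) (+-identityʳ _))
          ... | no  _ = trans (+-identityˡ _) (zeroʳ t)
          off′ : ∀ b → b ∉ S → b ∉ D ∖ a → c′ b ≈ 0#
          off′ b b∉S b∉ with b ≟ a
          ... | yes ≡.refl = x-x≈0 (sym (trans (*-assoc _ _ _)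
                               (trans (*-congˡ (inv-* (e a) ea≉0)) (*-identityʳ _))))
          ... | no  b≢a = x-x≈0 (trans (off b b∉S b∉D)
                            (sym (x*0 t (e-off b b∉S (b∉D ∘ p─q⊆p D ⁅ d ⁆)))))
            where b∉D = λ b∈D → b∉ (x∈p∧x≢y⇒x∈p-y b∈D b≢a)

  module _ {N} {K L : Set} (X : Fin N → K → Carrier) (Y : Fin N → L → Carrier) where
    private
      NX = Null X
      NY = Null Y
      NZ = Null (X ⊠ Y)
      subX = Null-isSubspace X
      subY = Null-isSubspace Y
      subZ = Null-isSubspace (X ⊠ Y)

    -- The inequality dim X + dim Y ≤ dim Z + 1 on `S`, by witnesses: spanning sets bound the left
    -- side from above, an independent set bounds dim Z from below. Positivity of `∣ A ∣` is kept
    -- for the truncated subtraction in `connected⇒spans`.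
    RankBound : Subset N → Set (c ⊔ ℓ)
    RankBound S = ∃ λ A → ∃ λ B → ∃ λ C →
      0 < ∣ A ∣ × (∀ {s} → s ∈ S → InSpan NX A s) × (∀ {s} → s ∈ S → InSpan NY B s) ×
      C ⊆ S × IndepMod NZ ⊥ C × ∣ A ∣ ℕ.+ ∣ B ∣ ≤ ℕ.suc ∣ C ∣

    add-ear : ∀ {G S} → Connected G NZ → S ⊆ G → Nonempty S → ¬ (G ⊆ S) → RankBound S →
              ∃ λ S′ → S′ ⊆ G × S ⊆ S′ × ∣ S ∣ < ∣ S′ ∣ × RankBound S′
    add-ear {G} {S} conn S⊆G neS G⊈S (A , B , C , 0<A , A-spans , B-spans , C⊆S , C-indep , bound) =
      -- Connectedness gives a relation on `G` that crosses `S`; a minimal crossing set `D` outside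
      -- `S` is the ear.
      let c₀ , Zc₀ , off₀ , ¬Zc₀↾S = conn S⊆G neS G⊈S
          D , D⊆ , (c , Zc , ¬Zc↾S , off) , min = minimal-crossing subZ (G ─ S)
            (c₀ , Zc₀ , ¬Zc₀↾S , λ b b∉S b∉ → off₀ b λ b∈G → b∉ (x∈p∧x∉q⇒x∈p─q b∈G b∉S))
          open Minimal subZ Zc ¬Zc↾S off min
          D∩S : ∀ {d} → d ∈ D → d ∉ S
          D∩S = λ d∈D → x∈p─q⇒x∉q G S (D⊆ d∈D)
          d , d∈D = nonempty
          A₁ , A₁⊆D , A₁-indep , A₁-spans = relative-basis subX em S D
          B₁ , bound₁ , B₁-spans =
            Factor.complement X Y Zc ¬Zc↾S off nonzero D∩S A₁⊆D A₁-indep A₁-spans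
          D∖d⊆D = p─q⊆p D ⁅ d ⁆
      in S ∪ D , [ S⊆G , p─q⊆p G S ∘ D⊆ ]′ ∘ x∈p∪q⁻ S D , p⊆p∪q D ,
         p⊂q⇒∣p∣<∣q∣ (p⊆p∪q D , d , x∈p∪q⁺ (inj₂ d∈D) , D∩S d∈D) ,
         A ∪ A₁ , B ∪ B₁ , C ∪ (D ∖ d) ,
         ℕ.≤-trans 0<A (∣p∣≤∣p∪q∣ A A₁) ,
         span-extend subX A-spans A₁-spans , span-extend subY B-spans B₁-spans ,
         [ p⊆p∪q D ∘ C⊆S , q⊆p∪q S D ∘ D∖d⊆D ]′ ∘ x∈p∪q⁻ C (D ∖ d) ,
         glue (indep d∈D) ,
         count {∣ A ∣} {∣ A₁ ∣} {∣ B ∣} {∣ B₁ ∣} {∣ C ∣} {∣ D ∖ d ∣}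
           (∣p∪q∣≤∣p∣+∣q∣ A A₁) (∣p∪q∣≤∣p∣+∣q∣ B B₁) bound
           -- The strictness of `bound₁` pays for the element `d` left out of the independent set.
           (ℕ.s≤s⁻¹ (ℕ.≤-trans bound₁ (∣p∣≤1+∣p-x∣ D d)))
           (disjoint⇒∣p∣+∣q∣≤∣p∪q∣ C (D ∖ d) λ x∈C x∈ → D∩S (D∖d⊆D x∈) (C⊆S x∈C))
      where
      -- As `C ⊆ S`, a relation on `C ∪ E` lives on `S ∪ E`; so it vanishes on `E`, and then on `C`.
      glue : ∀ {E} → IndepMod NZ S E → IndepMod NZ ⊥ (C ∪ E)
      glue {E} E-indep {c} Zc off {a} a∈ =
        [ C-indep Zc off′ , zero-on-E ]′ (x∈p∪q⁻ C E a∈)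
        where
        zero-on-E : ∀ {a} → a ∈ E → c a ≈ 0#
        zero-on-E = E-indep Zc λ b b∉S b∉E → off b ∉⊥ ([ b∉S ∘ C⊆S , b∉E ]′ ∘ x∈p∪q⁻ C E)
        off′ : ∀ b → b ∉ ⊥ → b ∉ C → c b ≈ 0#
        off′ b _ b∉C = [ zero-on-E , (λ b∉E → off b ∉⊥ ([ b∉C , b∉E ]′ ∘ x∈p∪q⁻ C E)) ]′ (toSum (b ∈? E))

      count : ∀ {a a₁ b b₁ c d x y z} → x ≤ a ℕ.+ a₁ → y ≤ b ℕ.+ b₁ → a ℕ.+ b ≤ ℕ.suc c →
              a₁ ℕ.+ b₁ ≤ d → c ℕ.+ d ≤ z → x ℕ.+ y ≤ ℕ.suc z
      count {a} {a₁} {b} {b₁} x≤ y≤ ≤c ≤d ≤z = ℕ.≤-trans (ℕ.+-mono-≤ x≤ y≤)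
        (ℕ.≤-trans (ℕ.≤-reflexive (+-interchange a a₁ b b₁))
        (ℕ.≤-trans (ℕ.+-mono-≤ ≤c ≤d) (s≤s ≤z)))

    -- Start from the singleton of `a`, where the bound reads 1 + 1 ≤ 1 + 1, and add ears until `G`
    -- is exhausted.
    connected⇒rankBound : ∀ {G a} → Connected G NZ → a ∈ G → ¬ NZ (δ a) → RankBound G
    connected⇒rankBound {G} {a} conn a∈G ¬Zδ =
      go ∣ G ∣ ⁅ a ⁆ (λ x∈ → ≡.subst (_∈ G) (≡.sym (x∈⁅y⁆⇒x≡y a x∈)) a∈G) (x∈⁅x⁆ a) (ℕ.m≤m+n _ _)
        (⁅ a ⁆ , ⁅ a ⁆ , ⁅ a ⁆ , ℕ.≤-reflexive (≡.sym (∣⁅x⁆∣≡1 a)) ,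
         self∈span subX , self∈span subY , id , singleton-indep subZ ¬Zδ ,
         ℕ.≤-reflexive (≡.cong (ℕ._+ ∣ ⁅ a ⁆ ∣) (∣⁅x⁆∣≡1 a)))
      where
      finish : ∀ {S} → S ⊆ G → G ⊆ S → RankBound S → RankBound G
      finish S⊆G G⊆S (A , B , C , 0<A , A-spans , B-spans , C⊆S , rest) =
        A , B , C , 0<A , A-spans ∘ G⊆S , B-spans ∘ G⊆S , S⊆G ∘ C⊆S , rest

      go : ∀ k S → S ⊆ G → a ∈ S → ∣ G ∣ ≤ k ℕ.+ ∣ S ∣ → RankBound S → RankBound G
      go ℕ.zero    S S⊆G a∈S ∣G∣≤ rb = finish S⊆G (p⊆q∧∣q∣≤∣p∣⇒q⊆p S⊆G ∣G∣≤) rb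
      go (ℕ.suc k) S S⊆G a∈S ∣G∣≤ rb with G ⊆? S
      ... | yes G⊆S = finish S⊆G G⊆S rb
      ... | no  G⊈S =
        let S′ , S′⊆G , S⊆S′ , ∣S∣< , rb′ = add-ear conn S⊆G (a , a∈S) G⊈S rb
        in go k S′ S′⊆G (S⊆S′ a∈S) (ℕ.≤-trans ∣G∣≤
             (ℕ.≤-trans (ℕ.≤-reflexive (≡.sym (ℕ.+-suc k ∣ S ∣))) (ℕ.+-monoʳ-≤ k ∣S∣<))) rb′

    -- If `c` crosses `S` in the product, then for some `k` the relation `c b * X b k` of `Y`
    -- crosses `S`; otherwise every coordinate of `c ↾ S` would vanish.
    connected-projʳ : ∀ {G} → Connected G NZ → Connected G NY
    connected-projʳ {G} conn {S} S⊆G neS G⊈S = decidable-stable em λ ¬cross →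
      let c , Zc , off , ¬Zc↾S = conn S⊆G neS G⊈S in
      ¬Zc↾S λ (k , l) → trans (sum-cong λ b → trans (sym (*-assoc ((c ↾ S) b) (X b k) (Y b l)))
          (*-congʳ (sym (↾-* c (λ b → X b k) b))))
        (decidable-stable (em-ℓ) (λ ¬Y → ¬cross
          ((λ b → c b * X b k) , ⊠-nullʳ X Y Zc k , (λ b b∉ → 0*x _ (off b b∉)) , ¬Y)) l)
      where
      ↾-* : ∀ (c f : Coeffs N) b → ((λ b → c b * f b) ↾ S) b ≈ (c ↾ S) b * f b
      ↾-* c f b with b ∈? S
      ... | yes _ = refl
      ... | no  _ = sym (zeroˡ _)

    nonzero-projʳ : ∀ {a} → ¬ NZ (δ a) → ¬ NY (δ a)
    nonzero-projʳ {a} ¬Zδ Yδ = ¬Zδ λ (k , l) → trans (sum-δ* a λ b → X b k * Y b l)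
      (x*0 (X a k) (trans (sym (sum-δ* a λ b → Y b l)) (Yδ l)))

  ⊠-all : ∀ {N t} → (Fin t → Fin N → Fin N → Carrier) → Fin N → Vec (Fin N) t → Carrier
  ⊠-all {t = ℕ.zero}  X a []      = 1#
  ⊠-all {t = ℕ.suc t} X a (k ∷ β) = X zero a k * ⊠-all (X ∘ suc) a β

  -- Induction on the number of factors. Dropping the first keeps `G` connected, and the independent
  -- set `C′` found for the others has at most `∣ B ∣` elements by Steinitz exchange. The two-factor
  -- bound then brings the first factor back.
  connected⇒spans : ∀ {N t} (X : Fin t → Fin N → Fin N → Carrier) {G : Subset N} {a} →
    Connected G (Null (⊠-all X)) → a ∈ G → ¬ Null (⊠-all X) (δ a) →
    ∃ λ (A : Fin t → Subset N) → (∀ i {g} → g ∈ G → InSpan (Null (X i)) (A i) g) ×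
    ∃ λ C → C ⊆ G × IndepMod (Null (⊠-all X)) ⊥ C × sumℕ (λ i → ∣ A i ∣ ∸ 1) ℕ.+ 1 ≤ ∣ C ∣
  connected⇒spans {t = ℕ.zero} X {G} {a} conn a∈G ¬Nδ =
    (λ ()) , (λ ()) , ⁅ a ⁆ , (λ x∈ → ≡.subst (_∈ G) (≡.sym (x∈⁅y⁆⇒x≡y a x∈)) a∈G) ,
    singleton-indep (Null-isSubspace (⊠-all X)) ¬Nδ , ℕ.≤-reflexive (≡.sym (∣⁅x⁆∣≡1 a))
  connected⇒spans {N} {ℕ.suc t} X {G} {a} conn a∈G ¬Nδ =
    let A , A-spans , C′ , C′⊆G , C′-indep , bound′ =
          connected⇒spans (X ∘ suc) {a = a} (connected-projʳ X₀ X₊ conn′) a∈G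
            (nonzero-projʳ X₀ X₊ {a} (¬Nδ ∘ join))
        A₀ , B , C , 0<A₀ , A₀-spans , B-spans , C⊆G , C-indep , bound =
          connected⇒rankBound X₀ X₊ conn′ a∈G (¬Nδ ∘ join)
    in (λ { zero → A₀ ; (suc i) → A i }) , (λ { zero → A₀-spans ; (suc i) → A-spans i }) ,
       C , C⊆G , (λ Nc → C-indep (split Nc)) ,
       count {∣ A₀ ∣} 0<A₀ (ℕ.≤-trans bound′ (steinitz (Null-isSubspace X₊) C′-indep (B-spans ∘ C′⊆G))) bound
    where
    X₀ = X zero
    X₊ = ⊠-all (X ∘ suc)
    split : ∀ {c} → Null (⊠-all X) c → Null (X₀ ⊠ X₊) c
    split Nc (k , β) = Nc (k ∷ β)
    join : ∀ {c} → Null (X₀ ⊠ X₊) c → Null (⊠-all X) c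
    join Nc (k ∷ β) = Nc (k , β)
    conn′ : Connected G (Null (X₀ ⊠ X₊))
    conn′ S⊆G neS G⊈S = let c , Nc , off , ¬Nc↾S = conn S⊆G neS G⊈S in c , split Nc , off , ¬Nc↾S ∘ join
    count : ∀ {a b c s} → 0 < a → s ℕ.+ 1 ≤ b → a ℕ.+ b ≤ ℕ.suc c → (a ∸ 1) ℕ.+ s ℕ.+ 1 ≤ c
    count {ℕ.suc a} {s = s} _ s≤ ≤c = ℕ.≤-trans (ℕ.≤-reflexive (ℕ.+-assoc a s 1))
      (ℕ.≤-trans (ℕ.+-monoʳ-≤ a s≤) (ℕ.s≤s⁻¹ ≤c))

-- Families in a vector space and partially defined linear functionals.

module Families {c ℓ v ℓv} (F : Field c ℓ) (W : VectorSpace F v ℓv) where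
  open Coefficients F
  open Module W
  open import Relation.Binary.Reasoning.Setoid ≈ᴹ-setoid
  open FiniteSum +ᴹ-commutativeMonoid public using () renaming
    (sum-cong to sumᴹ-cong; sum-zero to sumᴹ-zero; sum-only to sumᴹ-only; sum-↑ to sumᴹ-↑;
     ∑-distrib-+ to sumᴹ-distrib-+; ∑-comm to sumᴹ-comm)

  ∑ᴹ : ∀ {k} → (Fin k → Carrierᴹ) → Carrierᴹ
  ∑ᴹ = sumᴹ F W

  0*w : ∀ {r} w → r ≈ 0# → r *ₗ w ≈ᴹ 0ᴹ
  0*w w r≈0 = ≈ᴹ-trans (*ₗ-congʳ r≈0) (*ₗ-zeroˡ w)

  w-w≈0 : ∀ w → w +ᴹ (- 1#) *ₗ w ≈ᴹ 0ᴹ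
  w-w≈0 w = ≈ᴹ-trans (+ᴹ-congʳ (≈ᴹ-sym (*ₗ-identityˡ w)))
    (≈ᴹ-trans (≈ᴹ-sym (*ₗ-distribʳ w 1# (- 1#))) (0*w w (-‿inverseʳ 1#)))

  *ₗ-distribˡ-sumᴹ : ∀ {k} r (f : Fin k → Carrierᴹ) → r *ₗ ∑ᴹ f ≈ᴹ ∑ᴹ (λ i → r *ₗ f i)
  *ₗ-distribˡ-sumᴹ {ℕ.zero}  r f = *ₗ-zeroʳ r
  *ₗ-distribˡ-sumᴹ {ℕ.suc k} r f =
    ≈ᴹ-trans (*ₗ-distribˡ r _ _) (+ᴹ-congˡ (*ₗ-distribˡ-sumᴹ r (f ∘ suc)))

  *ₗ-distribʳ-sum : ∀ {k} (r : Coeffs k) w → sum r *ₗ w ≈ᴹ ∑ᴹ (λ i → r i *ₗ w)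
  *ₗ-distribʳ-sum {ℕ.zero}  r w = *ₗ-zeroˡ w
  *ₗ-distribʳ-sum {ℕ.suc k} r w =
    ≈ᴹ-trans (*ₗ-distribʳ w _ _) (+ᴹ-congˡ (*ₗ-distribʳ-sum (r ∘ suc) w))

  module _ {N} (e : Fin N → Carrierᴹ) where

    ⟪_⟫ : Coeffs N → Carrierᴹ
    ⟪ c ⟫ = ∑ᴹ (λ a → c a *ₗ e a)

    ⟪⟫-cong : ∀ {c d} → (∀ a → c a ≈ d a) → ⟪ c ⟫ ≈ᴹ ⟪ d ⟫
    ⟪⟫-cong c≈d = sumᴹ-cong λ a → *ₗ-congʳ (c≈d a)

    ⟪⟫-zero : ∀ {c} → (∀ a → c a ≈ 0#) → ⟪ c ⟫ ≈ᴹ 0ᴹ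
    ⟪⟫-zero c≈0 = sumᴹ-zero λ a → 0*w (e a) (c≈0 a)

    ⟪⟫-+ : ∀ c d → ⟪ (λ a → c a + d a) ⟫ ≈ᴹ ⟪ c ⟫ +ᴹ ⟪ d ⟫
    ⟪⟫-+ c d = ≈ᴹ-trans (sumᴹ-cong λ a → *ₗ-distribʳ (e a) (c a) (d a))
      (sumᴹ-distrib-+ (λ a → c a *ₗ e a) (λ a → d a *ₗ e a))

    ⟪⟫-* : ∀ s c → ⟪ (λ a → s * c a) ⟫ ≈ᴹ s *ₗ ⟪ c ⟫
    ⟪⟫-* s c = ≈ᴹ-trans (sumᴹ-cong λ a → *ₗ-assoc s (c a) (e a))
      (≈ᴹ-sym (*ₗ-distribˡ-sumᴹ s λ a → c a *ₗ e a))

    ⟪⟫-δ : ∀ a → ⟪ δ a ⟫ ≈ᴹ e a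
    ⟪⟫-δ a = ≈ᴹ-trans (sumᴹ-only (λ b → δ a b *ₗ e b) a λ b b≢a → 0*w (e b) (δ-off (b≢a ∘ ≡.sym)))
      (≈ᴹ-trans (*ₗ-congʳ (δ-diag a)) (*ₗ-identityˡ (e a)))

    ⟪⟫-sum : ∀ {k} (s : Coeffs k) (f : Fin k → Coeffs N) →
             ⟪ (λ a → sum λ i → s i * f i a) ⟫ ≈ᴹ ∑ᴹ (λ i → s i *ₗ ⟪ f i ⟫)
    ⟪⟫-sum {ℕ.zero}  s f = ⟪⟫-zero λ a → refl
    ⟪⟫-sum {ℕ.suc k} s f = ≈ᴹ-trans (⟪⟫-+ _ _)
      (+ᴹ-cong (⟪⟫-* (s zero) (f zero)) (⟪⟫-sum (s ∘ suc) (f ∘ suc)))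

    Relation : Pred (Coeffs N) ℓv
    Relation c = ⟪ c ⟫ ≈ᴹ 0ᴹ

    Relation-isSubspace : IsSubspace Relation
    Relation-isSubspace = record
      { respects = λ c≈d Rc → ≈ᴹ-trans (≈ᴹ-sym (⟪⟫-cong c≈d)) Rc
      ; 0-closed = ⟪⟫-zero λ a → refl
      ; +-closed = λ {c} {d} Rc Rd → ≈ᴹ-trans (⟪⟫-+ c d) (≈ᴹ-trans (+ᴹ-cong Rc Rd) (+ᴹ-identityˡ 0ᴹ))
      ; *-closed = λ s {c} Rc → ≈ᴹ-trans (⟪⟫-* s c) (≈ᴹ-trans (*ₗ-congˡ Rc) (*ₗ-zeroʳ s))
      }

    relation⇒≈ : ∀ {c d} → Relation (λ a → c a - d a) → ⟪ c ⟫ ≈ᴹ ⟪ d ⟫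
    relation⇒≈ {c} {d} R = begin
      ⟪ c ⟫                              ≈⟨ ⟪⟫-cong (λ a → sym (trans (+-assoc (c a) _ _)
                                              (trans (+-congˡ (-‿inverseˡ (d a))) (+-identityʳ (c a))))) ⟩
      ⟪ (λ a → (c a - d a) + d a) ⟫      ≈⟨ ⟪⟫-+ (λ a → c a - d a) d ⟩
      ⟪ (λ a → c a - d a) ⟫ +ᴹ ⟪ d ⟫     ≈⟨ +ᴹ-congʳ R ⟩
      0ᴹ +ᴹ ⟪ d ⟫                        ≈⟨ +ᴹ-identityˡ _ ⟩
      ⟪ d ⟫                              ∎

    -- The generators may have any index type, provided each occurs among the members of `G`; a span
    -- over part of a family can thus be compared with the whole family.
    span-coefficients : ∀ {k} {K : Set k} {f : K → Carrierᴹ} {G : Subset N} →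
      (∀ k → ∃ λ a → a ∈ G × f k ≈ᴹ e a) → ∀ {w} → Span F W f w → ∃ λ μ → Off G μ × w ≈ᴹ ⟪ μ ⟫
    span-coefficients {G = G} f∈ (gen k) =
      let a , a∈G , fk≈ea = f∈ k in
      δ a , (λ b b∉G → δ-off {a = a} {b} (b∉G ∘ λ a≡b → ≡.subst (_∈ G) a≡b a∈G)) ,
      ≈ᴹ-trans fk≈ea (≈ᴹ-sym (⟪⟫-δ a))
    span-coefficients f∈ zero = (λ _ → 0#) , (λ _ _ → refl) , ≈ᴹ-sym (⟪⟫-zero λ a → refl)
    span-coefficients f∈ (add p q) =
      let μ , μ-off , u≈ = span-coefficients f∈ p
          ν , ν-off , w≈ = span-coefficients f∈ q
      in (λ a → μ a + ν a) , (λ b b∉ → trans (+-cong (μ-off b b∉) (ν-off b b∉)) (+-identityˡ 0#)) ,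
         ≈ᴹ-trans (+ᴹ-cong u≈ w≈) (≈ᴹ-sym (⟪⟫-+ μ ν))
    span-coefficients f∈ (scale r p) =
      let μ , μ-off , u≈ = span-coefficients f∈ p
      in (λ a → r * μ a) , (λ b b∉ → x*0 r (μ-off b b∉)) , ≈ᴹ-trans (*ₗ-congˡ u≈) (≈ᴹ-sym (⟪⟫-* r μ))
    span-coefficients f∈ (resp u≈w p) =
      let μ , μ-off , u≈ = span-coefficients f∈ p
      in μ , μ-off , ≈ᴹ-trans (≈ᴹ-sym u≈w) u≈

    -- Write the `d` basis vectors through `A`. If `d` exceeded `∣ A ∣`, elimination would give a
    -- dependence between them.
    dim≤∣spanning∣ : ExcludedMiddle (c ⊔ ℓ) → ∀ {k} {K : Set k} {f : K → Carrierᴹ} {G A : Subset N} {d} →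
      (∀ k → ∃ λ a → a ∈ G × f k ≈ᴹ e a) → (∀ {g} → g ∈ G → InSpan Relation A g) →
      HasDim F W (Span F W f) d → d ≤ ∣ A ∣
    dim≤∣spanning∣ em {A = A} {d} f∈ G⊆ (b , b∈ , b-indep , _) with d ℕ.≤? ∣ A ∣
    ... | yes d≤ = d≤
    ... | no  d≰ =
      let s , _ , (j , sj≉0) , s-sum = LinearFamilies.linear-dependence F em (⊤ {d}) A (proj₁ ∘ coeffs)
            (λ {j} _ → proj₁ (proj₂ (coeffs j))) (≡.subst (∣ A ∣ <_) (≡.sym (∣⊤∣≡n d)) (ℕ.≰⇒> d≰))
      in contradiction (b-indep s (≈ᴹ-trans (sumᴹ-cong λ j → *ₗ-congˡ (proj₂ (proj₂ (coeffs j))))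
           (≈ᴹ-trans (≈ᴹ-sym (⟪⟫-sum s (proj₁ ∘ coeffs))) (⟪⟫-zero s-sum))) j) sj≉0
      where
      coeffs : ∀ j → ∃ λ ν → Off A ν × b j ≈ᴹ ⟪ ν ⟫
      coeffs j =
        let μ , μ-off , b≈ = span-coefficients f∈ (b∈ j)
            ν , ν-off , Rν = change-span Relation-isSubspace μ-off G⊆
        in ν , ν-off , ≈ᴹ-trans b≈ (relation⇒≈ Rν)

  -- The graph of a linear functional on a subspace.  A functional on all of W extending a given one
  -- need not exist without choice; one-step extensions do.
  record LinearGraph : Set (Level.suc (c ⊔ ℓ ⊔ v ⊔ ℓv)) where
    field
      Graph        : Carrierᴹ → Carrier → Set (c ⊔ ℓ ⊔ v ⊔ ℓv)
      respects     : ∀ {u w r s} → u ≈ᴹ w → r ≈ s → Graph u r → Graph w s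
      zero-graph   : Graph 0ᴹ 0#
      +-graph      : ∀ {u w r s} → Graph u r → Graph w s → Graph (u +ᴹ w) (r + s)
      *-graph      : ∀ x {u r} → Graph u r → Graph (x *ₗ u) (x * r)
      single-value : ∀ {r} → Graph 0ᴹ r → r ≈ 0#

    Defined : Carrierᴹ → Set (c ⊔ ℓ ⊔ v ⊔ ℓv)
    Defined u = ∃ (Graph u)

    unique : ∀ {u r s} → Graph u r → Graph u s → r ≈ s
    unique {u} {r} {s} p q = x∙y⁻¹≈ε⇒x≈y r s (single-value
        (respects (w-w≈0 u) (+-congˡ (-1*x≈-x s)) (+-graph p (*-graph (- 1#) q))))
      where open import Algebra.Properties.Group +-group using (x∙y⁻¹≈ε⇒x≈y)

  module _ (em : ExcludedMiddle (c ⊔ ℓ ⊔ v ⊔ ℓv)) where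
    open LinearGraph

    infix 4 _⊑_
    _⊑_ : LinearGraph → LinearGraph → Set (c ⊔ ℓ ⊔ v ⊔ ℓv)
    φ ⊑ ψ = ∀ {u r} → Graph φ u r → Graph ψ u r

    -- A vector `w` outside the domain receives the value zero: `u` takes the value of `φ` at
    -- `u +ᴹ s *ₗ w`, for any scalar `s` for which this is defined.
    extend : ∀ φ w → ∃ λ ψ → φ ⊑ ψ × Defined ψ w
    extend φ w with em {Defined φ w}
    ... | yes def = φ , id , def
    ... | no ¬def = ψ , (λ {u} p → 0# , respects φ
            (≈ᴹ-sym (≈ᴹ-trans (+ᴹ-congˡ (*ₗ-zeroˡ w)) (+ᴹ-identityʳ u))) refl p) ,
          0# , - 1# , respects φ (≈ᴹ-sym (w-w≈0 w)) refl (zero-graph φ)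
      where
      open import Algebra.Properties.CommutativeSemigroup
        (CommutativeMonoid.commutativeSemigroup +ᴹ-commutativeMonoid) using (interchange)
      ψ : LinearGraph
      ψ .Graph u r = ∃ λ s → Graph φ (u +ᴹ s *ₗ w) r
      ψ .respects u≈ r≈ (s , p) = s , respects φ (+ᴹ-congʳ u≈) r≈ p
      ψ .zero-graph = 0# , respects φ (≈ᴹ-sym (≈ᴹ-trans (+ᴹ-identityˡ _) (*ₗ-zeroˡ w))) refl (zero-graph φ)
      ψ .+-graph (s , p) (s′ , q) = s + s′ , respects φ
        (≈ᴹ-trans (interchange _ _ _ _) (+ᴹ-congˡ (≈ᴹ-sym (*ₗ-distribʳ w s s′)))) refl (+-graph φ p q)
      ψ .*-graph x (s , p) = x * s , respects φ
        (≈ᴹ-trans (*ₗ-distribˡ x _ _) (+ᴹ-congˡ (≈ᴹ-sym (*ₗ-assoc x s w)))) refl (*-graph φ x p)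
      ψ .single-value {r} (s , p) with lower-em (c ⊔ v ⊔ ℓv) em {s ≈ 0#}
      ... | yes s≈0 = single-value φ (respects φ (≈ᴹ-trans (+ᴹ-identityˡ _) (0*w w s≈0)) refl p)
      -- Here `s *ₗ w` is in the domain of `φ` and `s` is invertible, so `w` would be in the domain
      -- too.
      ... | no  s≉0 = contradiction (inv s s≉0 * r , respects φ
              (≈ᴹ-trans (*ₗ-congˡ (+ᴹ-identityˡ _)) (≈ᴹ-trans (≈ᴹ-sym (*ₗ-assoc _ s w))
                (≈ᴹ-trans (*ₗ-congʳ (inv-* s s≉0)) (*ₗ-identityˡ w)))) refl
              (*-graph φ (inv s s≉0) p)) ¬def

    extend-all : ∀ φ ws → ∃ λ ψ → φ ⊑ ψ × All (Defined ψ) ws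
    extend-all φ []       = φ , id , []
    extend-all φ (w ∷ ws) =
      let ψ , φ⊑ψ , ws-def = extend-all φ ws
          χ , ψ⊑χ , w-def  = extend ψ w
      in χ , ψ⊑χ ∘ φ⊑ψ , w-def ∷ All.map (λ (r , p) → r , ψ⊑χ p) ws-def

    -- Zero outside the domain.
    value : LinearGraph → Carrierᴹ → Carrier
    value φ u with em {Defined φ u}
    ... | yes (r , _) = r
    ... | no  _       = 0#

    value-graph : ∀ φ {u r} → Graph φ u r → value φ u ≈ r
    value-graph φ {u} p with em {Defined φ u}
    ... | yes (_ , q) = unique φ q p
    ... | no  ¬def    = contradiction (_ , p) ¬def

-- Multilinearity of finite products.

module Products {c ℓ} (F : Field c ℓ) where
  open Coefficients F
  module Π = FiniteSum *-commutativeMonoid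

  ∏ : ∀ {k} → Coeffs k → Carrier
  ∏ = Π.sum

  ∏-+ : ∀ {k} i (f g h : Coeffs k) → f i ≈ g i + h i →
        (∀ j → j ≢ i → f j ≈ g j × f j ≈ h j) → ∏ f ≈ ∏ g + ∏ h
  ∏-+ zero f g h f≈ rest = trans (*-congʳ f≈) (trans (distribʳ _ _ _)
    (+-cong (*-congˡ (Π.sum-cong λ j → proj₁ (rest (suc j) λ ())))
            (*-congˡ (Π.sum-cong λ j → proj₂ (rest (suc j) λ ())))))
  ∏-+ (suc i) f g h f≈ rest =
    trans (*-congˡ (∏-+ i (f ∘ suc) (g ∘ suc) (h ∘ suc) f≈
      λ j j≢i → rest (suc j) λ { ≡.refl → j≢i ≡.refl }))
    (trans (distribˡ _ _ _) (+-cong (*-congʳ (proj₁ (rest zero λ ()))) (*-congʳ (proj₂ (rest zero λ ())))))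

  ∏-* : ∀ {k} i r (f g : Coeffs k) → f i ≈ r * g i →
        (∀ j → j ≢ i → f j ≈ g j) → ∏ f ≈ r * ∏ g
  ∏-* zero r f g f≈ rest = trans (*-cong f≈ (Π.sum-cong λ j → rest (suc j) λ ())) (*-assoc _ _ _)
  ∏-* (suc i) r f g f≈ rest =
    trans (*-cong (rest zero λ ()) (∏-* i r (f ∘ suc) (g ∘ suc) f≈
      λ j j≢i → rest (suc j) λ { ≡.refl → j≢i ≡.refl }))
    (trans (sym (*-assoc _ _ _)) (trans (*-congʳ (*-comm _ _)) (*-assoc _ _ _)))

-- Tensor products grouped along a partition of the factors.

module Blocks {c ℓ v ℓv} (F : Field c ℓ) {m} (V : Fin m → VectorSpace F v ℓv)
  (em : ExcludedMiddle (c ⊔ ℓ ⊔ v ⊔ ℓv)) {t} {J : Fin t → Subset m} (isPartition : IsPartition J) where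
  open Coefficients F
  open Products F
  open IsPartition isPartition
  private
    module V j = Module (V j)
    em-F : ExcludedMiddle (c ⊔ ℓ)
    em-F = lower-em (v ⊔ ℓv) em
  open Connectivity F em-F
  open LinearFamilies F em-F using (Null; Null-isSubspace; coordinates)

  Tuple : Set v
  Tuple = ∀ j → V.Carrierᴹ j

  Block : Fin t → VectorSpace F (c ⊔ v) (c ⊔ ℓ ⊔ v ⊔ ℓv)
  Block i = ⨂[_] F V (J i)

  private
    module B i = Families F (Block i)
    module Bᴹ i = Module (Block i)
    module W = Module (⨂ F V)
    module WF = Families F (⨂ F V)

  block : ∀ i → Tuple → Module.Carrierᴹ (Block i)
  block i z = ⊗ λ (j , _) → z j

  part : Fin m → Fin t
  part j = proj₁ (covers j)

  ∈part : ∀ j → j ∈ J (part j)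
  ∈part j = proj₂ (covers j)

  -- A derivation of s ≈⊗ t mentions finitely many tuples, so it is respected by block functionals
  -- that are linear only on a subspace containing the blocks of these tuples.
  tuples : ∀ {s t} → _≈⊗_ F V s t → List Tuple
  tuples (≈sym p)     = tuples p
  tuples (≈trans p q) = tuples p List.++ tuples q
  tuples (⊕-cong p q) = tuples p List.++ tuples q
  tuples (⊙-cong _ p) = tuples p
  tuples (⊗-cong {z} {z′} _)        = z ∷ z′ ∷ []
  tuples (⊗-add _ {z} {z₁} {z₂} _ _) = z ∷ z₁ ∷ z₂ ∷ []
  tuples (⊗-scale _ _ {z} {z₁} _ _)  = z ∷ z₁ ∷ []
  tuples _ = []

  block-cong : ∀ i {z z₁ : Tuple} → (∀ j → j ∈ J i → V._≈ᴹ_ j (z j) (z₁ j)) →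
               _≈⊗_ F _ (block i z) (block i z₁)
  block-cong i z≈ = ⊗-cong λ (j , j∈) → z≈ j j∈

  ∉-other : ∀ {i j k} → i ≢ part j → k ∈ J i → k ≢ j
  ∉-other {j = j} i≢ k∈ ≡.refl = i≢ (disjoint k∈ (∈part j))

  module _ (φ : ∀ i → B.LinearGraph i) where
    private module φ i = B.LinearGraph i (φ i)

    value : ∀ i → Module.Carrierᴹ (Block i) → Carrier
    value i = B.value i em (φ i)

    -- The tensor product of the block functionals. It is defined on terms, since it respects only
    -- those derivations whose tuples have all blocks in the domains.
    eval : Tensor F V → Carrier
    eval (⊗ z)   = ∏ λ i → value i (block i z)
    eval 𝟎       = 0#
    eval (s ⊕ t) = eval s + eval t
    eval (r ⊙ s) = r * eval s

    AllDefined : Tuple → Set (c ⊔ ℓ ⊔ v ⊔ ℓv)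
    AllDefined z = ∀ i → φ.Defined i (block i z)

    private
      val : ∀ {i u r} → φ.Graph i u r → value i u ≈ r
      val {i} = B.value-graph i em (φ i)

      val-cong : ∀ {i u w} → φ.Defined i u → φ.Defined i w → Module._≈ᴹ_ (Block i) u w → value i u ≈ value i w
      val-cong {i} (r , p) (s , q) u≈w = trans (val p) (sym (val (φ.respects i u≈w refl p)))

    -- A change in slot `j` affects only the block that contains `j`; there the functional is
    -- linear, and the other factors of the product stay equal.
    eval-sound : ∀ {s t} (p : _≈⊗_ F V s t) → All AllDefined (tuples p) → eval s ≈ eval t
    eval-sound ≈refl _ = refl
    eval-sound (≈sym p) def = sym (eval-sound p def)
    eval-sound (≈trans p q) def =
      trans (eval-sound p (++⁻ˡ (tuples p) def)) (eval-sound q (++⁻ʳ (tuples p) def))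
    eval-sound (⊕-cong p q) def =
      +-cong (eval-sound p (++⁻ˡ (tuples p) def)) (eval-sound q (++⁻ʳ (tuples p) def))
    eval-sound (⊙-cong r≈ p) def = *-cong r≈ (eval-sound p def)
    eval-sound (⊕-assoc s t u) _ = +-assoc _ _ _
    eval-sound (⊕-comm s t) _ = +-comm _ _
    eval-sound (⊕-identityˡ s) _ = +-identityˡ _
    eval-sound (⊙-zeroˡ s) _ = zeroˡ _
    eval-sound (⊙-identityˡ s) _ = *-identityˡ _
    eval-sound (⊙-assoc r r′ s) _ = *-assoc _ _ _
    eval-sound (⊙-distribˡ r s t) _ = distribˡ _ _ _
    eval-sound (⊙-distribʳ s r r′) _ = distribʳ _ _ _
    eval-sound (⊗-cong z≈) (def ∷ def′ ∷ []) =
      Π.sum-cong λ i → val-cong (def i) (def′ i) (block-cong i λ j _ → z≈ j)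
    eval-sound (⊗-add j {z} {z₁} {z₂} eq rest) (def ∷ def₁ ∷ def₂ ∷ []) =
      ∏-+ (part j) _ _ _
        (trans (val (φ.respects i (≈sym here-add) refl (φ.+-graph i p₁ p₂)))
          (+-cong (sym (val p₁)) (sym (val p₂))))
        λ k k≢ → val-cong (def k) (def₁ k) (block-cong k λ l l∈ → proj₁ (rest l (∉-other k≢ l∈))) ,
                 val-cong (def k) (def₂ k) (block-cong k λ l l∈ → proj₂ (rest l (∉-other k≢ l∈)))
      where
      i = part j
      p₁ = proj₂ (def₁ i)
      p₂ = proj₂ (def₂ i)
      here-add : _≈⊗_ F _ (block i z) (block i z₁ ⊕ block i z₂)
      -- A slot of a block is an index with a membership proof; as such proofs are unique, different
      -- slots have different indices.
      here-add = ⊗-add (j , ∈part j) eq λ (k , k∈) k≢ →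
        rest k λ { ≡.refl → k≢ (≡.cong (j ,_) ([]=-irrelevant k∈ (∈part j))) }
    eval-sound (⊗-scale j r {z} {z₁} eq rest) (def ∷ def₁ ∷ []) =
      ∏-* (part j) r _ _
        (trans (val (φ.respects i (≈sym here-scale) refl (φ.*-graph i r p₁))) (*-congˡ (sym (val p₁))))
        λ k k≢ → val-cong (def k) (def₁ k) (block-cong k λ l l∈ → rest l (∉-other k≢ l∈))
      where
      i = part j
      p₁ = proj₂ (def₁ i)
      here-scale : _≈⊗_ F _ (block i z) (r ⊙ block i z₁)
      here-scale = ⊗-scale (j , ∈part j) r eq λ (k , k∈) k≢ →
        rest k λ { ≡.refl → k≢ (≡.cong (j ,_) ([]=-irrelevant k∈ (∈part j))) }

    eval-sum : ∀ {k} (s : Coeffs k) (z : Fin k → Tuple) →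
               eval (sumᴹ F (⨂ F V) λ a → s a ⊙ ⊗ z a) ≈ sum (λ a → s a * eval (⊗ z a))
    eval-sum {ℕ.zero}  s z = refl
    eval-sum {ℕ.suc k} s z = +-congˡ (eval-sum (s ∘ suc) (z ∘ suc))

  insert : ∀ i → Tuple → (∀ ((j , _) : ∃ (_∈ J i)) → V.Carrierᴹ j) → Tuple
  insert i y z j with j ∈? J i
  ... | yes j∈ = z (j , j∈)
  ... | no  _  = y j

  -- The linear map that tensors an element of block `i` with the components of `y` in all other
  -- slots.
  inject : ∀ i → Tuple → Module.Carrierᴹ (Block i) → Tensor F V
  inject i y (⊗ z)   = ⊗ insert i y z
  inject i y 𝟎       = 𝟎
  inject i y (s ⊕ t) = inject i y s ⊕ inject i y t
  inject i y (r ⊙ s) = r ⊙ inject i y s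

  inject-cong : ∀ i y {s t} → Module._≈ᴹ_ (Block i) s t → _≈⊗_ F V (inject i y s) (inject i y t)
  inject-cong i y ≈refl = ≈refl
  inject-cong i y (≈sym p) = ≈sym (inject-cong i y p)
  inject-cong i y (≈trans p q) = ≈trans (inject-cong i y p) (inject-cong i y q)
  inject-cong i y (⊕-cong p q) = ⊕-cong (inject-cong i y p) (inject-cong i y q)
  inject-cong i y (⊙-cong r≈ p) = ⊙-cong r≈ (inject-cong i y p)
  inject-cong i y (⊕-assoc s t u) = ⊕-assoc _ _ _
  inject-cong i y (⊕-comm s t) = ⊕-comm _ _
  inject-cong i y (⊕-identityˡ s) = ⊕-identityˡ _
  inject-cong i y (⊙-zeroˡ s) = ⊙-zeroˡ _
  inject-cong i y (⊙-identityˡ s) = ⊙-identityˡ _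
  inject-cong i y (⊙-assoc r r′ s) = ⊙-assoc _ _ _
  inject-cong i y (⊙-distribˡ r s t) = ⊙-distribˡ _ _ _
  inject-cong i y (⊙-distribʳ s r r′) = ⊙-distribʳ _ _ _
  inject-cong i y (⊗-cong {z} {z′} z≈) = ⊗-cong eq
    where
    eq : ∀ j → V._≈ᴹ_ j (insert i y z j) (insert i y z′ j)
    eq j with j ∈? J i
    ... | yes j∈ = z≈ (j , j∈)
    ... | no  _  = V.≈ᴹ-refl j
  inject-cong i y (⊗-add (j , j∈) {z} {z₁} {z₂} eq rest) = ⊗-add j eq′ rest′
    where
    eq′ : V._≈ᴹ_ j (insert i y z j) (V._+ᴹ_ j (insert i y z₁ j) (insert i y z₂ j))
    eq′ with j ∈? J i
    ... | no  j∉  = contradiction j∈ j∉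
    ... | yes j∈′ with []=-irrelevant j∈ j∈′
    ...   | ≡.refl = eq
    rest′ : ∀ k → k ≢ j →
            V._≈ᴹ_ k (insert i y z k) (insert i y z₁ k) × V._≈ᴹ_ k (insert i y z k) (insert i y z₂ k)
    rest′ k k≢j with k ∈? J i
    ... | yes k∈ = rest (k , k∈) λ { ≡.refl → k≢j ≡.refl }
    ... | no  _  = V.≈ᴹ-refl k , V.≈ᴹ-refl k
  inject-cong i y (⊗-scale (j , j∈) r {z} {z₁} eq rest) = ⊗-scale j r eq′ rest′
    where
    eq′ : V._≈ᴹ_ j (insert i y z j) (V._*ₗ_ j r (insert i y z₁ j))
    eq′ with j ∈? J i
    ... | no  j∉  = contradiction j∈ j∉
    ... | yes j∈′ with []=-irrelevant j∈ j∈′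
    ...   | ≡.refl = eq
    rest′ : ∀ k → k ≢ j → V._≈ᴹ_ k (insert i y z k) (insert i y z₁ k)
    rest′ k k≢j with k ∈? J i
    ... | yes k∈ = rest (k , k∈) λ { ≡.refl → k≢j ≡.refl }
    ... | no  _  = V.≈ᴹ-refl k

  inject-sum : ∀ {k} i y (s : Coeffs k) (f : Fin k → Module.Carrierᴹ (Block i)) →
    inject i y (sumᴹ F (Block i) λ a → s a ⊙ f a) ≡ sumᴹ F (⨂ F V) (λ a → s a ⊙ inject i y (f a))
  inject-sum {ℕ.zero}  i y s f = ≡.refl
  inject-sum {ℕ.suc k} i y s f = ≡.cong (s zero ⊙ inject i y (f zero) ⊕_) (inject-sum i y (s ∘ suc) (f ∘ suc))

  -- Expand the first argument of `M` in coordinates. For each `b` the coefficients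
  -- `s a * X zero a b` are null for the remaining factors, so induction applies.
  expand-multilinear : ∀ {N t} (X : Fin t → Fin N → Fin N → Carrier) (M : Vec (Fin N) t → Tensor F V) →
    (∀ i β a → _≈⊗_ F V (M (β [ i ]≔ a)) (sumᴹ F (⨂ F V) λ b → X i a b ⊙ M (β [ i ]≔ b))) →
    ∀ {s} → Null (⊠-all X) s → WF.Relation (λ a → M (replicate t a)) s
  expand-multilinear {N} {ℕ.zero} X M lin {s} null =
    ≈trans (≈sym (WF.*ₗ-distribʳ-sum s (M [])))
      (WF.0*w (M []) (trans (sum-cong λ a → sym (*-identityʳ (s a))) (null [])))
  expand-multilinear {N} {ℕ.suc t} X M lin {s} null = begin
    ∑ᴹ (λ a → s a ⊙ M (a ∷ replicate t a))
      ≈⟨ sumᴹ-cong (λ a → ⊙-cong refl (lin zero (a ∷ replicate t a) a)) ⟩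
    ∑ᴹ (λ a → s a ⊙ ∑ᴹ (λ b → X zero a b ⊙ M (b ∷ replicate t a)))
      ≈⟨ sumᴹ-cong (λ a → *ₗ-distribˡ-sumᴹ (s a) (λ b → X zero a b ⊙ M (b ∷ replicate t a))) ⟩
    ∑ᴹ (λ a → ∑ᴹ (λ b → s a ⊙ X zero a b ⊙ M (b ∷ replicate t a)))
      ≈⟨ sumᴹ-comm (λ a b → s a ⊙ X zero a b ⊙ M (b ∷ replicate t a)) ⟩
    ∑ᴹ (λ b → ∑ᴹ (λ a → s a ⊙ X zero a b ⊙ M (b ∷ replicate t a)))
      ≈⟨ sumᴹ-zero (λ b → ≈trans (sumᴹ-cong λ a → ≈sym (⊙-assoc (s a) (X zero a b) _))
           (expand-multilinear (X ∘ suc) (M ∘ (b ∷_)) (λ i β a → lin (suc i) (b ∷ β) a)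
             λ β → trans (sum-cong λ a → *-assoc (s a) (X zero a b) _) (null (b ∷ β)))) ⟩
    𝟎 ∎
    where
    open WF
    open import Relation.Binary.Reasoning.Setoid W.≈ᴹ-setoid

  -- Relations between product tensors, expressed by block coordinates.

  module _ {N} (e : Fin N → Tuple) where

    BlockRelation : ∀ i → Pred (Coeffs N) (c ⊔ ℓ ⊔ v ⊔ ℓv)
    BlockRelation i = B.Relation i (block i ∘ e)

    private
      coords : ∀ i → _
      coords i = coordinates (B.Relation-isSubspace i (block i ∘ e)) em

    X : Fin t → Fin N → Fin N → Carrier
    X i = proj₁ (coords i)

    X-represents : ∀ i a → BlockRelation i (λ b → δ a b - X i a b)
    X-represents i = proj₁ (proj₂ (coords i))

    block-relation⇒null : ∀ i {s} → BlockRelation i s → Null (X i) s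
    block-relation⇒null i = proj₁ (proj₂ (proj₂ (coords i)))

    null⇒block-relation : ∀ i {s} → Null (X i) s → BlockRelation i s
    null⇒block-relation i = proj₂ (proj₂ (proj₂ (coords i)))

    -- The coordinate functional at `k` on the span of the `i`-th blocks of `e`. It is single-valued
    -- because relations between the blocks are null for `X i`.
    coordinate-graph : ∀ i → Fin N → B.LinearGraph i
    coordinate-graph i k = record
      { Graph        = λ u r → ∃ λ s → u ≈ⁱ ⟪ s ⟫ × r ≈ coord s
      ; respects     = λ u≈w r≈s (s , u≈ , r≈) → s , ≈trans (≈sym u≈w) u≈ , trans (sym r≈s) r≈
      ; zero-graph   = (λ _ → 0#) , ≈sym (B.⟪⟫-zero i (block i ∘ e) λ a → refl) , sym (N.0-closed k)
      ; +-graph      = λ (s , u≈ , r≈) (s′ , w≈ , r′≈) → (λ a → s a + s′ a) ,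
          ≈trans (⊕-cong u≈ w≈) (≈sym (B.⟪⟫-+ i (block i ∘ e) s s′)) ,
          trans (+-cong r≈ r′≈) (sym (trans (sum-cong λ a → distribʳ (X i a k) (s a) (s′ a))
            (∑-distrib-+ (λ a → s a * X i a k) (λ a → s′ a * X i a k))))
      ; *-graph      = λ x (s , u≈ , r≈) → (λ a → x * s a) ,
          ≈trans (⊙-cong refl u≈) (≈sym (B.⟪⟫-* i (block i ∘ e) x s)) ,
          trans (*-congˡ r≈) (trans (*-distribˡ-sum x λ a → s a * X i a k)
            (sum-cong λ a → sym (*-assoc x (s a) (X i a k))))
      ; single-value = λ (s , 0≈ , r≈) → trans r≈ (block-relation⇒null i (≈sym 0≈) k)
      }
      where
      module N = IsSubspace (Null-isSubspace (X i))
      _≈ⁱ_ = Bᴹ._≈ᴹ_ i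
      ⟪_⟫ = B.⟪_⟫ i (block i ∘ e)
      coord : Coeffs N → Carrier
      coord s = sum (λ a → s a * X i a k)

    -- For each multi-index `β`, extend the coordinate functionals to the blocks of the finitely
    -- many tuples in the derivation `p`, and apply their product to both sides.
    relation⇒null : ∀ {s} → WF.Relation (λ a → ⊗ e a) s → Null (⊠-all X) s
    relation⇒null {s} p β = begin
      sum (λ a → s a * ⊠-all X a β)        ≈⟨ sum-cong (λ a → *-congˡ (eval-e a)) ⟨
      sum (λ a → s a * eval ψ (⊗ e a))     ≈⟨ eval-sum ψ s e ⟨
      eval ψ (WF.⟪_⟫ (λ a → ⊗ e a) s)      ≈⟨ eval-sound ψ p all-defined ⟩
      0#                                   ∎
      where
      open import Relation.Binary.Reasoning.Setoid setoid
      extended : ∀ i → _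
      extended i = B.extend-all i em (coordinate-graph i (lookup β i)) (List.map (block i) (tuples p))
      ψ : ∀ i → B.LinearGraph i
      ψ i = proj₁ (extended i)
      all-defined : All (AllDefined ψ) (tuples p)
      all-defined = All.tabulate λ z∈ i → All.lookup (map⁻ (proj₂ (proj₂ (extended i)))) z∈
      ∏-lookup : ∀ {t} (X : Fin t → Fin N → Fin N → Carrier) a β → ∏ (λ i → X i a (lookup β i)) ≈ ⊠-all X a β
      ∏-lookup X a []      = refl
      ∏-lookup X a (k ∷ β) = *-congˡ (∏-lookup (X ∘ suc) a β)
      eval-e : ∀ a → eval ψ (⊗ e a) ≈ ⊠-all X a β
      eval-e a = trans (Π.sum-cong λ i → B.value-graph i em (ψ i) (proj₁ (proj₂ (extended i))
          (δ a , ≈sym (B.⟪⟫-δ i (block i ∘ e) a) , sym (sum-δ* a λ b → X i b (lookup β i)))))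
        (∏-lookup X a β)

    -- `M β` takes its block `i` from the member `lookup β i`. It is linear in each block, and
    -- `⊗ e a` is its value at the constant multi-index `a`.
    null⇒relation : ∀ {s} → Null (⊠-all X) s → WF.Relation (λ a → ⊗ e a) s
    null⇒relation {s} null = ≈trans
      (WF.sumᴹ-cong λ a → ⊙-cong refl (⊗-cong λ j →
        V.≈ᴹ-reflexive j (≡.cong (λ b → e b j) (≡.sym (lookup-replicate (part j) a)))))
      (expand-multilinear X M linear null)
      where
      M : Vec (Fin N) t → Tensor F V
      M β = ⊗ λ j → e (lookup β (part j)) j

      M-update : ∀ i β a → _≈⊗_ F V (M (β [ i ]≔ a)) (inject i (λ j → e (lookup β (part j)) j) (block i (e a)))
      M-update i β a = ⊗-cong eq
        where
        eq : ∀ j → V._≈ᴹ_ j (e (lookup (β [ i ]≔ a) (part j)) j)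
                             (insert i (λ j → e (lookup β (part j)) j) (λ (j , _) → e a j) j)
        eq j with j ∈? J i
        ... | yes j∈ = V.≈ᴹ-reflexive j (≡.cong (λ b → e b j) (≡.trans
                (≡.cong (lookup (β [ i ]≔ a)) (disjoint (∈part j) j∈)) (lookup∘update i β a)))
        ... | no  j∉ = V.≈ᴹ-reflexive j (≡.cong (λ b → e b j)
                (lookup∘update′ {i = part j} {i}
                  (λ part≡i → j∉ (≡.subst (λ k → j ∈ J k) part≡i (∈part j))) β a))

      linear : ∀ i β a → _≈⊗_ F V (M (β [ i ]≔ a)) (sumᴹ F (⨂ F V) λ b → X i a b ⊙ M (β [ i ]≔ b))
      linear i β a = begin
        M (β [ i ]≔ a)
          ≈⟨ M-update i β a ⟩
        inject i y (block i (e a))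
          -- The expression of the `i`-th block of `e a` in coordinates is carried to whole tensors
          -- by `inject`.
          ≈⟨ inject-cong i y (≈trans (≈sym (B.⟪⟫-δ i (block i ∘ e) a))
               (B.relation⇒≈ i (block i ∘ e) {δ a} {X i a} (X-represents i a))) ⟩
        inject i y (B.⟪_⟫ i (block i ∘ e) (X i a))
          ≡⟨ inject-sum i y (X i a) (block i ∘ e) ⟩
        WF.∑ᴹ (λ b → X i a b ⊙ inject i y (block i (e b)))
          ≈⟨ WF.sumᴹ-cong (λ b → ⊙-cong refl (≈sym (M-update i β b))) ⟩
        WF.∑ᴹ (λ b → X i a b ⊙ M (β [ i ]≔ b)) ∎
        where
        open import Relation.Binary.Reasoning.Setoid W.≈ᴹ-setoid
        y : Tuple
        y j = e (lookup β (part j)) j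

-- Index sets with two halves, and functions glued along a subset.

sumℕ-mono-≤ : ∀ {k} {f g : Fin k → ℕ} → (∀ i → f i ≤ g i) → sumℕ f ≤ sumℕ g
sumℕ-mono-≤ {ℕ.zero}  f≤g = z≤n
sumℕ-mono-≤ {ℕ.suc k} f≤g = ℕ.+-mono-≤ (f≤g zero) (sumℕ-mono-≤ (f≤g ∘ suc))

module Halves (n r : ℕ) where

  left : Subset (n ℕ.+ r) → Subset n
  left = Vec.take n

  right : Subset (n ℕ.+ r) → Subset r
  right = Vec.drop n

  ∣left∣+∣right∣ : ∀ G → ∣ G ∣ ≡ ∣ left G ∣ ℕ.+ ∣ right G ∣
  ∣left∣+∣right∣ G = ≡.trans (≡.cong ∣_∣ (≡.sym (take++drop≡id n G))) (∣++∣ (left G) (right G))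

  private
    lookup-left : ∀ G a → Vec.lookup G (a ↑ˡ r) ≡ Vec.lookup (left G) a
    lookup-left G a = ≡.trans (≡.cong (λ G → Vec.lookup G (a ↑ˡ r)) (≡.sym (take++drop≡id n G)))
      (lookup-++ˡ (left G) (right G) a)

    lookup-right : ∀ G b → Vec.lookup G (n ↑ʳ b) ≡ Vec.lookup (right G) b
    lookup-right G b = ≡.trans (≡.cong (λ G → Vec.lookup G (n ↑ʳ b)) (≡.sym (take++drop≡id n G)))
      (lookup-++ʳ (left G) (right G) b)

  ∈left⁺ : ∀ {G a} → a ↑ˡ r ∈ G → a ∈ left G
  ∈left⁺ {G} {a} a∈ = lookup⇒[]= a _ (≡.trans (≡.sym (lookup-left G a)) ([]=⇒lookup a∈))

  ∈left⁻ : ∀ {G a} → a ∈ left G → a ↑ˡ r ∈ G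
  ∈left⁻ {G} {a} a∈ = lookup⇒[]= _ G (≡.trans (lookup-left G a) ([]=⇒lookup a∈))

  ∈right⁺ : ∀ {G b} → n ↑ʳ b ∈ G → b ∈ right G
  ∈right⁺ {G} {b} b∈ = lookup⇒[]= b _ (≡.trans (≡.sym (lookup-right G b)) ([]=⇒lookup b∈))

  ∈right⁻ : ∀ {G b} → b ∈ right G → n ↑ʳ b ∈ G
  ∈right⁻ {G} {b} b∈ = lookup⇒[]= _ G (≡.trans (lookup-right G b) ([]=⇒lookup b∈))

  left-∪ : ∀ {G G′} → left G ⊆ left G′ ∪ left (G ─ G′)
  left-∪ {G} {G′} {a} a∈ with a ∈? left G′
  ... | yes a∈′ = x∈p∪q⁺ (inj₁ a∈′)
  ... | no  a∉′ = x∈p∪q⁺ (inj₂ (∈left⁺ {G ─ G′} (x∈p∧x∉q⇒x∈p─q (∈left⁻ {G} a∈) (a∉′ ∘ ∈left⁺ {G′}))))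

  right-∪ : ∀ {G G′} → right G ⊆ right G′ ∪ right (G ─ G′)
  right-∪ {G} {G′} {b} b∈ with b ∈? right G′
  ... | yes b∈′ = x∈p∪q⁺ (inj₁ b∈′)
  ... | no  b∉′ = x∈p∪q⁺ (inj₂ (∈right⁺ {G ─ G′} (x∈p∧x∉q⇒x∈p─q (∈right⁻ {G} b∈) (b∉′ ∘ ∈right⁺ {G′}))))

  left-mono : ∀ {G G′} → G′ ⊆ G → left G′ ⊆ left G
  left-mono {G} {G′} G′⊆G a∈ = ∈left⁺ {G} (G′⊆G (∈left⁻ {G′} a∈))

  right-mono : ∀ {G G′} → G′ ⊆ G → right G′ ⊆ right G
  right-mono {G} {G′} G′⊆G b∈ = ∈right⁺ {G} (G′⊆G (∈right⁻ {G′} b∈))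

  left-disjoint : ∀ {G G′ a} → a ∈ left (G ─ G′) → a ∉ left G′
  left-disjoint {G} {G′} a∈ a∈′ = x∈p─q⇒x∉q G G′ (∈left⁻ {G ─ G′} a∈) (∈left⁻ {G′} a∈′)

  right-disjoint : ∀ {G G′ b} → b ∈ right (G ─ G′) → b ∉ right G′
  right-disjoint {G} {G′} b∈ b∈′ = x∈p─q⇒x∉q G G′ (∈right⁻ {G ─ G′} b∈) (∈right⁻ {G′} b∈′)

override : ∀ {n} {B : Set} → Subset n → (Fin n → B) → (Fin n → B) → Fin n → B
override S f g a = if does (a ∈? S) then f a else g a

override-∈ : ∀ {n} {B : Set} {S : Subset n} (f g : Fin n → B) {a} → a ∈ S → override S f g a ≡ f a
override-∈ {S = S} f g {a} a∈S with a ∈? S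
... | yes _   = ≡.refl
... | no  a∉S = contradiction a∈S a∉S

override-∉ : ∀ {n} {B : Set} {S : Subset n} (f g : Fin n → B) {a} → a ∉ S → override S f g a ≡ g a
override-∉ {S = S} f g {a} a∉S with a ∈? S
... | yes a∈S = contradiction a∈S a∉S
... | no  _   = ≡.refl

-- Zero-sum subfamilies of two decompositions.

module Comparison {c ℓ v ℓv} (em : ExcludedMiddle (c ⊔ ℓ ⊔ v ⊔ ℓv)) (F : Field c ℓ) {n m : ℕ}
  (V : Fin m → VectorSpace F v ℓv)
  (x : Fin n → (j : Fin m) → Module.Carrierᴹ (V j))
  (x-product : ∀ a → IsProductTensor F V (⊗ x a))
  (rank-condition : ∀ (S : Subset n) → 2 ≤ ∣ S ∣ → ∣ S ∣ ≤ n →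
    Σ ℕ λ t → Σ (Fin t → Subset m) λ J → IsPartition J ×
    Σ (Fin t → ℕ) λ d → (∀ i → IsDim F V x S (J i) (d i)) ×
    2 ℕ.* ∣ S ∣ ≤ sumℕ (λ i → d i ∸ 1) ℕ.+ 1)
  {r : ℕ} (y : Fin r → Tensor F V) (y-product : ∀ b → IsProductTensor F V (y b)) where

  open Coefficients F
  open Halves n r
  private
    module W = Module (⨂ F V)
    module WF = Families F (⨂ F V)
    infix 4 _≋_
    _≋_ = _≈⊗_ F V
    z = λ b → proj₁ (proj₂ (y-product b))
    em-F : ExcludedMiddle (c ⊔ ℓ)
    em-F = lower-em (v ⊔ ℓv) em

  e : Fin (n ℕ.+ r) → (j : Fin m) → Module.Carrierᴹ (V j)
  e k = [ x , z ]′ (splitAt n k)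

  sign : Coeffs (n ℕ.+ r)
  sign k = [ (λ _ → 1#) , (λ _ → - 1#) ]′ (splitAt n k)

  e-left : ∀ a → e (a ↑ˡ r) ≡ x a
  e-left a = ≡.cong [ x , z ]′ (splitAt-↑ˡ n a r)

  e-right : ∀ b → e (n ↑ʳ b) ≡ z b
  e-right b = ≡.cong [ x , z ]′ (splitAt-↑ʳ n r b)

  y≋e : ∀ b → ⊗ e (n ↑ʳ b) ≋ y b
  y≋e b = ≈trans (W.≈ᴹ-reflexive (≡.cong ⊗_ (e-right b))) (≈sym (proj₂ (proj₂ (y-product b))))

  e≉0 : ∀ k → ¬ (⊗ e k ≋ 𝟎)
  e≉0 k with splitAt n k
  ... | inj₁ a = proj₁ (x-product a)
  ... | inj₂ b = proj₁ (y-product b) ∘ ≈trans (proj₂ (proj₂ (y-product b)))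

  sign≉0 : ∀ k → sign k ≉ 0#
  sign≉0 k with splitAt n k
  ... | inj₁ _ = 1≉0
  ... | inj₂ _ = λ -1≈0 → 1≉0 (trans (sym (-‿involutive 1#)) (trans (-‿cong -1≈0) -0#≈0#))

  Vanishing : Pred (Coeffs (n ℕ.+ r)) (c ⊔ ℓ ⊔ v ⊔ ℓv)
  Vanishing = WF.Relation (λ k → ⊗ e k)

  private module R = IsSubspace (WF.Relation-isSubspace (λ k → ⊗ e k))

  ZeroSum : Subset (n ℕ.+ r) → Set (c ⊔ ℓ ⊔ v ⊔ ℓv)
  ZeroSum G = Vanishing (sign ↾ G)

  ProperZeroSum : Subset (n ℕ.+ r) → Set (c ⊔ ℓ ⊔ v ⊔ ℓv)
  ProperZeroSum G = ∃ λ G′ → G′ ⊆ G × Nonempty G′ × ¬ (G ⊆ G′) × ZeroSum G′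

  split-sum : ∀ G → WF.⟪_⟫ (λ k → ⊗ e k) (sign ↾ G) ≋
    WF.∑ᴹ (λ a → ((λ _ → 1#) ↾ left G) a ⊙ ⊗ x a) ⊕ WF.∑ᴹ (λ b → ((λ _ → - 1#) ↾ right G) b ⊙ y b)
  split-sum G = ≈trans (WF.sumᴹ-↑ n (λ k → (sign ↾ G) k ⊙ ⊗ e k))
    (⊕-cong (WF.sumᴹ-cong λ a → ⊙-cong (coeffˡ a) (W.≈ᴹ-reflexive (≡.cong ⊗_ (e-left a))))
            (WF.sumᴹ-cong λ b → ⊙-cong (coeffʳ b) (y≋e b)))
    where
    coeffˡ : ∀ a → (sign ↾ G) (a ↑ˡ r) ≈ ((λ _ → 1#) ↾ left G) a
    coeffˡ a with (a ↑ˡ r) ∈? G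
    ... | yes a∈ = trans (reflexive (≡.cong [ (λ _ → 1#) , (λ _ → - 1#) ]′ (splitAt-↑ˡ n a r)))
                     (sym (↾-on (λ _ → 1#) (∈left⁺ {G} a∈)))
    ... | no  a∉ = sym (↾-off (λ _ → 1#) (left G) a (a∉ ∘ ∈left⁻ {G}))
    coeffʳ : ∀ b → (sign ↾ G) (n ↑ʳ b) ≈ ((λ _ → - 1#) ↾ right G) b
    coeffʳ b with (n ↑ʳ b) ∈? G
    ... | yes b∈ = trans (reflexive (≡.cong [ (λ _ → 1#) , (λ _ → - 1#) ]′ (splitAt-↑ʳ n r b)))
                     (sym (↾-on (λ _ → - 1#) (∈right⁺ {G} b∈)))
    ... | no  b∉ = sym (↾-off (λ _ → - 1#) (right G) b (b∉ ∘ ∈right⁻ {G}))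

  zeroSum-─ : ∀ {G G′} → G′ ⊆ G → ZeroSum G → ZeroSum G′ → ZeroSum (G ─ G′)
  zeroSum-─ {G} {G′} G′⊆G ZG ZG′ = R.respects eq (R.−-closed ZG ZG′)
    where
    eq : ∀ k → (sign ↾ G) k - (sign ↾ G′) k ≈ (sign ↾ (G ─ G′)) k
    eq k with k ∈? G′
    ... | yes k∈′ = trans (x-x≈0 (↾-on sign (G′⊆G k∈′)))
                      (sym (↾-off sign (G ─ G′) k λ k∈ → x∈p─q⇒x∉q G G′ k∈ k∈′))
    ... | no  k∉′ = trans (trans (+-congˡ -0#≈0#) (+-identityʳ _)) (same (k ∈? G))
      where
      same : Dec (k ∈ G) → (sign ↾ G) k ≈ (sign ↾ (G ─ G′)) k
      same (yes k∈) = trans (↾-on sign k∈) (sym (↾-on sign (x∈p∧x∉q⇒x∈p─q k∈ k∉′)))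
      same (no  k∉) = trans (↾-off sign G k k∉) (sym (↾-off sign (G ─ G′) k (k∉ ∘ p─q⊆p G G′)))

  minimal⇒left<right : ∀ {G} → ZeroSum G → ¬ ProperZeroSum G → 2 ≤ ∣ left G ∣ → ∣ left G ∣ < ∣ right G ∣
  minimal⇒left<right {G} ZG minimal 2≤ =
    let t , J , isPartition , d , dims , 2∣S∣≤ = rank-condition (left G) 2≤ (∣p∣≤n (left G))
        open Blocks F V em isPartition
        open Connectivity F em-F
        open LinearFamilies F em-F using (Null)
        a , a∈left = 0<∣p∣⇒nonempty (left G) (ℕ.≤-trans (s≤s z≤n) 2≤)
        a∈G = ∈left⁻ {G} a∈left
        -- The one relation `sign ↾ G` crosses every `S`: restricted to `S` it is `sign ↾ S`, which
        -- by minimality is no relation.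
        conn : Connected G (Null (⊠-all (X e)))
        conn = λ {S} S⊆G neS G⊈S → (sign ↾ G) , relation⇒null e ZG , ↾-off sign G ,
          λ null → minimal (S , S⊆G , neS , G⊈S , R.respects (↾-↾ S⊆G) (null⇒relation e null))
        A , A-spans , C , C⊆G , C-indep , bound = connected⇒spans (X e) conn a∈G
          (λ null → e≉0 (a ↑ˡ r) (≈trans (≈sym (WF.⟪⟫-δ (λ k → ⊗ e k) (a ↑ˡ r))) (null⇒relation e null)))
        -- `A i` spans the blocks of all members of `G`, in particular those coming from `x`, whose
        -- span has dimension `d i`.
        d≤ : ∀ i → d i ≤ ∣ A i ∣
        d≤ i = Families.dim≤∣spanning∣ F (Block i) (λ k → block i (e k)) em-F
          (λ (a , a∈S) → a ↑ˡ r , ∈left⁻ {G} a∈S ,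
            Module.≈ᴹ-reflexive (Block i) (≡.cong (block i) (≡.sym (e-left a))))
          (λ g∈G → let μ , off , null = A-spans i g∈G in μ , off , null⇒block-relation e i null)
          (dims i)
        -- `sign ↾ G` is a relation with no zero on `G`, so the independent set `C` is not all of
        -- `G`.
        C≢G : ¬ (G ⊆ C)
        C≢G G⊆C = sign≉0 (a ↑ˡ r) (trans (sym (↾-on sign a∈G))
          (C-indep (relation⇒null e ZG) (λ b _ b∉C → ↾-off sign G b (b∉C ∘ G⊆C)) (G⊆C a∈G)))
        ∣C∣<∣G∣ = ℕ.≰⇒> λ ∣G∣≤∣C∣ → C≢G (p⊆q∧∣q∣≤∣p∣⇒q⊆p C⊆G ∣G∣≤∣C∣)
    in count (ℕ.≤-trans 2∣S∣≤ (ℕ.≤-trans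
         (ℕ.+-monoˡ-≤ 1 (sumℕ-mono-≤ λ i → ℕ.∸-monoˡ-≤ 1 (d≤ i))) bound))
         (≡.subst (∣ C ∣ <_) (∣left∣+∣right∣ G) ∣C∣<∣G∣)
    where
    ↾-↾ : ∀ {S} → S ⊆ G → ∀ k → (sign ↾ G ↾ S) k ≈ (sign ↾ S) k
    ↾-↾ {S} S⊆G k with k ∈? S
    ... | yes k∈ = ↾-on sign (S⊆G k∈)
    ... | no  _  = refl
    count : ∀ {s q c} → 2 ℕ.* s ≤ c → c < s ℕ.+ q → s < q
    count {s} {q} 2s≤c c<s+q = ℕ.+-cancelˡ-< s s q (ℕ.≤-<-trans
      (ℕ.≤-reflexive (≡.cong (s ℕ.+_) (≡.sym (ℕ.+-identityʳ s)))) (ℕ.≤-<-trans 2s≤c c<s+q))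

  -- A bijection given by total maps, inverse to each other on the two subsets; totality lets
  -- `override` glue matchings of disjoint parts.
  Matching : Subset n → Subset r → Set (c ⊔ ℓ ⊔ v ⊔ ℓv)
  Matching S T = ∃ λ (f : Fin n → Fin r) → ∃ λ (g : Fin r → Fin n) →
    (∀ {a} → a ∈ S → f a ∈ T × g (f a) ≡ a × ⊗ x a ≋ y (f a)) ×
    (∀ {b} → b ∈ T → g b ∈ S × f (g b) ≡ b)

  -- In this form the property passes to disjoint unions: the inequality always holds, and a
  -- matching is claimed only in the case of equality. The two elements serve as default values.
  Matched : Subset (n ℕ.+ r) → Set (c ⊔ ℓ ⊔ v ⊔ ℓv)
  Matched G = ∣ left G ∣ ≤ ∣ right G ∣ ×
    (∣ right G ∣ ≤ ∣ left G ∣ → Fin n → Fin r → Matching (left G) (right G))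

  -- With two or more `x` the inequality is strict and no matching is claimed. With a single `x`, an
  -- empty right half would make it zero, and a right half of one element makes the two equal.
  minimal⇒matched : ∀ {G} → ZeroSum G → ¬ ProperZeroSum G → Matched G
  minimal⇒matched {G} ZG minimal with ∣ left G ∣ in ∣L∣
  -- Equality leaves both halves empty, so the maps take default values only.
  ... | 0 = z≤n , λ ∣R∣≤0 a b → (λ _ → b) , (λ _ → a) ,
    (λ a∈ → contradiction (≡.subst (0 <_) ∣L∣ (x∈p⇒0<∣p∣ a∈)) λ ()) ,
    (λ b∈ → contradiction (ℕ.≤-trans (x∈p⇒0<∣p∣ b∈) ∣R∣≤0) λ ())
  ... | ℕ.suc (ℕ.suc k) =
    let L<R = ≡.subst (_< ∣ right G ∣) ∣L∣
          (minimal⇒left<right ZG minimal (≡.subst (2 ≤_) (≡.sym ∣L∣) (s≤s (s≤s z≤n))))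
    in ℕ.<⇒≤ L<R , λ R≤L → contradiction R≤L (ℕ.<⇒≱ L<R)
  ... | 1 = 1≤∣R∣ , λ ∣R∣≤1 _ _ →
    let b , b∈R = 0<∣p∣⇒nonempty (right G) 1≤∣R∣ in
    (λ _ → b) , (λ _ → a) ,
    (λ {a′} a′∈L → b∈R , ∣p∣≤1⇒unique ∣L∣≤1 a∈L a′∈L ,
      ≡.subst (λ a → ⊗ x a ≋ y b) (∣p∣≤1⇒unique ∣L∣≤1 a∈L a′∈L) (x≋y ∣R∣≤1 b∈R)) ,
    (λ b′∈R → a∈L , ∣p∣≤1⇒unique ∣R∣≤1 b∈R b′∈R)
    where
    ∣L∣≤1 = ℕ.≤-reflexive ∣L∣
    L-nonempty = 0<∣p∣⇒nonempty (left G) (≡.subst (0 <_) (≡.sym ∣L∣) (s≤s z≤n))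
    a = proj₁ L-nonempty
    a∈L = proj₂ L-nonempty

    only : ∀ {k} {S : Subset k} (u : Fin k → Tensor F V) s {i} → ∣ S ∣ ≤ 1 → i ∈ S →
           WF.∑ᴹ (λ j → ((λ _ → s) ↾ S) j ⊙ u j) ≋ s ⊙ u i
    only {S = S} u s {i} ∣S∣≤1 i∈S = ≈trans
      (WF.sumᴹ-only _ i λ j j≢i → WF.0*w (u j)
        (↾-off (λ _ → s) S j λ j∈S → j≢i (∣p∣≤1⇒unique ∣S∣≤1 j∈S i∈S)))
      (⊙-cong (↾-on (λ _ → s) i∈S) ≈refl)

    x+rest≋0 : ⊗ x a ⊕ WF.∑ᴹ (λ b → ((λ _ → - 1#) ↾ right G) b ⊙ y b) ≋ 𝟎
    x+rest≋0 = ≈trans (⊕-cong (≈sym (≈trans (only (λ a → ⊗ x a) 1# ∣L∣≤1 a∈L) (⊙-identityˡ _))) ≈refl)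
      (≈trans (≈sym (split-sum G)) ZG)

    1≤∣R∣ : 1 ≤ ∣ right G ∣
    1≤∣R∣ with 1 ℕ.≤? ∣ right G ∣
    ... | yes p = p
    ... | no ¬p = contradiction (≈trans (≈sym (W.+ᴹ-identityʳ (⊗ x a))) (≈trans (⊕-cong ≈refl
          (≈sym (WF.sumᴹ-zero λ b → WF.0*w (y b)
            (↾-off (λ _ → - 1#) (right G) b λ b∈ → ¬p (x∈p⇒0<∣p∣ b∈))))) x+rest≋0))
        (proj₁ (x-product a))

    x≋y : ∣ right G ∣ ≤ 1 → ∀ {b} → b ∈ right G → ⊗ x a ≋ y b
    x≋y ∣R∣≤1 {b} b∈R = x∙y⁻¹≈ε⇒x≈y (⊗ x a) (y b)
      (≈trans (⊕-cong ≈refl (≈sym (only y (- 1#) ∣R∣≤1 b∈R))) x+rest≋0)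
      where open import Algebra.Properties.Group W.+ᴹ-group using (x∙y⁻¹≈ε⇒x≈y)

  -- The left half is at most the right half in both parts, so equality of the totals forces
  -- equality in each part, and the two matchings are glued.
  combine : ∀ {G G′} → G′ ⊆ G → Matched G′ → Matched (G ─ G′) → Matched G
  combine {G} {G′} G′⊆G (l₁≤r₁ , m₁) (l₂≤r₂ , m₂) =
    ℕ.≤-trans l≤ (ℕ.≤-trans (ℕ.+-mono-≤ l₁≤r₁ l₂≤r₂) ≤r) ,
    λ r≤l a b → union (m₁ (squeezeˡ l₂≤r₂ (total r≤l)) a b) (m₂ (squeezeʳ l₁≤r₁ (total r≤l)) a b)
    where
    G₂ = G ─ G′
    l≤ : ∣ left G ∣ ≤ ∣ left G′ ∣ ℕ.+ ∣ left G₂ ∣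
    l≤ = ℕ.≤-trans (p⊆q⇒∣p∣≤∣q∣ (left-∪ {G} {G′})) (∣p∪q∣≤∣p∣+∣q∣ (left G′) (left G₂))
    ≤r : ∣ right G′ ∣ ℕ.+ ∣ right G₂ ∣ ≤ ∣ right G ∣
    ≤r = ℕ.≤-trans (disjoint⇒∣p∣+∣q∣≤∣p∪q∣ (right G′) (right G₂)
        λ b∈′ b∈ → right-disjoint {G} {G′} b∈ b∈′)
      (p⊆q⇒∣p∣≤∣q∣ ([ right-mono {G} {G′} G′⊆G , right-mono {G} {G₂} (p─q⊆p G G′) ]′ ∘
        x∈p∪q⁻ (right G′) (right G₂)))
    total : ∣ right G ∣ ≤ ∣ left G ∣ → ∣ right G′ ∣ ℕ.+ ∣ right G₂ ∣ ≤ ∣ left G′ ∣ ℕ.+ ∣ left G₂ ∣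
    total r≤l = ℕ.≤-trans ≤r (ℕ.≤-trans r≤l l≤)
    squeezeˡ : ∀ {l₁ l₂ r₁ r₂} → l₂ ≤ r₂ → r₁ ℕ.+ r₂ ≤ l₁ ℕ.+ l₂ → r₁ ≤ l₁
    squeezeˡ {l₁} {l₂} {r₁} l₂≤r₂ h = ℕ.+-cancelʳ-≤ l₂ r₁ l₁ (ℕ.≤-trans (ℕ.+-monoʳ-≤ r₁ l₂≤r₂) h)
    squeezeʳ : ∀ {l₁ l₂ r₁ r₂} → l₁ ≤ r₁ → r₁ ℕ.+ r₂ ≤ l₁ ℕ.+ l₂ → r₂ ≤ l₂
    squeezeʳ {l₁} {l₂} {r₁} {r₂} l₁≤r₁ h = ℕ.+-cancelˡ-≤ l₁ r₂ l₂ (ℕ.≤-trans (ℕ.+-monoˡ-≤ r₂ l₁≤r₁) h)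

    union : Matching (left G′) (right G′) → Matching (left G₂) (right G₂) → Matching (left G) (right G)
    union (f₁ , g₁ , fwd₁ , bwd₁) (f₂ , g₂ , fwd₂ , bwd₂) = f , g ,
      (λ {a} a∈ → [ fwd-∈ , fwd-─ ]′ (x∈p∪q⁻ (left G′) (left G₂) (left-∪ {G} {G′} a∈))) ,
      (λ {b} b∈ → [ bwd-∈ , bwd-─ ]′ (x∈p∪q⁻ (right G′) (right G₂) (right-∪ {G} {G′} b∈)))
      where
      f = override (left G′) f₁ f₂
      g = override (right G′) g₁ g₂
      fwd-∈ : ∀ {a} → a ∈ left G′ → f a ∈ right G × g (f a) ≡ a × ⊗ x a ≋ y (f a)
      fwd-∈ {a} a∈ rewrite override-∈ f₁ f₂ a∈ =
        let b∈ , gf , x≋ = fwd₁ a∈ in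
        right-mono {G} {G′} G′⊆G b∈ , ≡.trans (override-∈ g₁ g₂ b∈) gf , x≋
      fwd-─ : ∀ {a} → a ∈ left G₂ → f a ∈ right G × g (f a) ≡ a × ⊗ x a ≋ y (f a)
      fwd-─ {a} a∈ rewrite override-∉ f₁ f₂ (left-disjoint {G} {G′} a∈) =
        let b∈ , gf , x≋ = fwd₂ a∈ in
        right-mono {G} {G₂} (p─q⊆p G G′) b∈ ,
        ≡.trans (override-∉ g₁ g₂ (right-disjoint {G} {G′} b∈)) gf , x≋
      bwd-∈ : ∀ {b} → b ∈ right G′ → g b ∈ left G × f (g b) ≡ b
      bwd-∈ {b} b∈ rewrite override-∈ g₁ g₂ b∈ =
        let a∈ , fg = bwd₁ b∈ in left-mono {G} {G′} G′⊆G a∈ , ≡.trans (override-∈ f₁ f₂ a∈) fg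
      bwd-─ : ∀ {b} → b ∈ right G₂ → g b ∈ left G × f (g b) ≡ b
      bwd-─ {b} b∈ rewrite override-∉ g₁ g₂ (right-disjoint {G} {G′} b∈) =
        let a∈ , fg = bwd₂ b∈ in
        left-mono {G} {G₂} (p─q⊆p G G′) a∈ , ≡.trans (override-∉ f₁ f₂ (left-disjoint {G} {G′} a∈)) fg

  -- Induction on the size of `G`: a proper zero-sum part and its complement, again of zero sum, are
  -- both smaller.
  zeroSum⇒matched : ∀ {G} → ZeroSum G → Matched G
  zeroSum⇒matched {G} = go ∣ G ∣ ℕ.≤-refl
    where
    go : ∀ k {G} → ∣ G ∣ ≤ k → ZeroSum G → Matched G
    go k {G} ∣G∣≤k ZG with em {ProperZeroSum G}
    ... | no minimal = minimal⇒matched ZG minimal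
    go ℕ.zero {G} ∣G∣≤k ZG | yes (G′ , G′⊆G , (a , a∈G′) , _) =
      contradiction (ℕ.≤-trans (x∈p⇒0<∣p∣ (G′⊆G a∈G′)) ∣G∣≤k) λ ()
    go (ℕ.suc k) {G} ∣G∣≤k ZG | yes (G′ , G′⊆G , (a , a∈G′) , G⊈G′ , ZG′) =
      combine {G} {G′} G′⊆G
        (go k (ℕ.s≤s⁻¹ (ℕ.≤-trans (ℕ.≰⇒> λ ∣G∣≤∣G′∣ → G⊈G′ (p⊆q∧∣q∣≤∣p∣⇒q⊆p G′⊆G ∣G∣≤∣G′∣)) ∣G∣≤k)) ZG′)
        (go k (ℕ.s≤s⁻¹ (ℕ.≤-trans (p∩q≢∅⇒∣p─q∣<∣p∣ G G′ (a , x∈p∩q⁺ (G′⊆G a∈G′ , a∈G′))) ∣G∣≤k))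
          (zeroSum-─ G′⊆G ZG ZG′))

  equal-sums⇒matched : WF.∑ᴹ (λ a → ⊗ x a) ≋ WF.∑ᴹ y → Matched ⊤
  equal-sums⇒matched x≋y = zeroSum⇒matched {⊤} (begin
    WF.⟪_⟫ (λ k → ⊗ e k) (sign ↾ ⊤)
      ≈⟨ split-sum ⊤ ⟩
    WF.∑ᴹ (λ a → ((λ _ → 1#) ↾ left ⊤) a ⊙ ⊗ x a) ⊕ WF.∑ᴹ (λ b → ((λ _ → - 1#) ↾ right ⊤) b ⊙ y b)
      ≈⟨ ⊕-cong (WF.sumᴹ-cong λ a → ≈trans (⊙-cong (↾-on (λ _ → 1#) (∈left⁺ {⊤} {a} ∈⊤)) ≈refl)
                  (⊙-identityˡ (⊗ x a)))
                (WF.sumᴹ-cong λ b → ⊙-cong {s = y b} (↾-on (λ _ → - 1#) (∈right⁺ {⊤} {b} ∈⊤)) ≈refl) ⟩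
    WF.∑ᴹ (λ a → ⊗ x a) ⊕ WF.∑ᴹ (λ b → (- 1#) ⊙ y b)
      ≈⟨ ⊕-cong x≋y (≈sym (WF.*ₗ-distribˡ-sumᴹ (- 1#) y)) ⟩
    WF.∑ᴹ y ⊕ (- 1#) ⊙ WF.∑ᴹ y
      ≈⟨ W.-ᴹ‿inverseʳ (WF.∑ᴹ y) ⟩
    𝟎 ∎)
    where open import Relation.Binary.Reasoning.Setoid W.≈ᴹ-setoid

theorem5p2 : ∀ {c ℓ v ℓv} → ExcludedMiddle (c ⊔ ℓ ⊔ v ⊔ ℓv) →
    (F : Field c ℓ) (n m : ℕ) → 2 ≤ n → 3 ≤ m →
    (V : Fin m → VectorSpace F v ℓv) →
    (x : Fin n → (j : Fin m) → Module.Carrierᴹ (V j)) →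
    (∀ a → IsProductTensor F V (⊗ x a)) →
    (∀ (S : Subset n) → 2 ≤ ∣ S ∣ → ∣ S ∣ ≤ n →
    Σ ℕ λ t → Σ (Fin t → Subset m) λ J → IsPartition J ×
    Σ (Fin t → ℕ) λ d → (∀ i → IsDim F V x S (J i) (d i)) ×
    2 ℕ.* ∣ S ∣ ≤ sumℕ (λ i → d i ∸ 1) ℕ.+ 1) →
    IsUniqueTensorRankDecomposition F V (sumᴹ F (⨂ F V) (λ a → ⊗ x a)) (λ a → ⊗ x a)
theorem5p2 em F (ℕ.suc n) m 2≤n 3≤m V x x-product rank-condition =
  x-product , ≈refl , λ r r≤n y y-product x≋y →
    let open Comparison em F V x x-product rank-condition y y-product
        open Halves (ℕ.suc n) r
        n≤∣left∣ : ℕ.suc n ≤ ∣ left ⊤ ∣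
        n≤∣left∣ = ≡.subst (_≤ ∣ left ⊤ ∣) (∣⊤∣≡n (ℕ.suc n)) (p⊆q⇒∣p∣≤∣q∣ {p = ⊤} λ _ → ∈left⁺ {⊤} ∈⊤)
        -- Applied to all indices this gives `n≤r`. With `r≤n` the halves have equal size, and the
        -- matching of the full halves is a permutation.
        left≤right , matching = equal-sums⇒matched x≋y
        n≤r = ℕ.≤-trans n≤∣left∣ (ℕ.≤-trans left≤right (∣p∣≤n (right ⊤)))
        f , g , fwd , bwd = matching (ℕ.≤-trans (∣p∣≤n (right ⊤)) (ℕ.≤-trans r≤n n≤∣left∣))
          -- Default elements, available because the first index set is non-empty and `r` is at
          -- least its size.
          zero (inject≤ zero n≤r)
    in ℕ.≤-antisym r≤n n≤r ,
       permutation f g (λ b → proj₂ (bwd (∈right⁺ {⊤} ∈⊤))) (λ a → proj₁ (proj₂ (fwd (∈left⁺ {⊤} ∈⊤)))) ,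
       λ a → proj₂ (proj₂ (fwd (∈left⁺ {⊤} ∈⊤)))
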